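{- For all integers $n\geq 0$, \begin{align*} a_{37}(43n+12)&\equiv 0 \pmod{43}, & a_{41}(47n+21)&\equiv 0 \pmod{47}, \\ a_{53}(59n+56)&\equiv 0 \pmod{59}, & a_{61}(67n+19)&\equiv 0 \pmod{67},\\ a_{65}(71n+32)&\equiv 0 \pmod{71}, & a_{73}(79n+62)&\equiv 0 \pmod{79},\\ a_{77}(83n+79)&\equiv 0 \pmod{83}. & & \end{align*}
   Context: For an integer $k\geq 1$ let $f_k:=\prod_{n\geq 1}(1-q^{kn})$. For an integer $c\geq 1$, the generalized cubic partition function $a_c(n)$ is defined by the generating function $\sum_{n\geq 0}a_c(n)q^n=\dfrac{1}{f_1f_2^{c-1}}$ (so $a_c(0)=1$). -}

module Defs where

open import Data.Bool.Base using (if_then_else_)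
open import Data.Fin.Base using (Fin; zero; suc; toℕ)
open import Data.Fin.Properties using (toℕ<n)
open import Data.Integer.Base using (ℤ; _+_; _-_; _*_; 0ℤ; 1ℤ)
import Data.Integer.Properties as ℤ
open import Data.Integer.Tactic.RingSolver using (solve-∀)
open import Data.Nat.Base as ℕ using (ℕ; zero; suc; pred; _∸_; _≡ᵇ_; _<_; _≤_; _≤′_; ≤′-refl; ≤′-step; s≤s; NonZero)
import Data.Nat.Properties as ℕ
open import Relation.Binary.PropositionalEquality
open import Relation.Nullary.Decidable using (dec-false)
open import Function.Base using (_∘_)

open import Algebra.Properties.Semiring.Sum ℤ.+-*-semiring
  using (sum⁺-syntax; sum-cong-≗; sum-replicate-zero; sum)

-- Formal power series over ℤ; A n is the coefficient of qⁿ.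
Series : Set
Series = ℕ → ℤ

infixl 6 _⊖_
infixl 7 _⊛_ _÷_
infixr 8 _^^_

q^_ : ℕ → Series
(q^ m) n = if m ≡ᵇ n then 1ℤ else 0ℤ

𝟙 : Series
𝟙 = q^ 0

_⊖_ : Series → Series → Series
(A ⊖ B) n = A n - B n

_⊛_ : Series → Series → Series
(A ⊛ B) n = ∑[ i ≤ n ] (A (toℕ i) * B (n ∸ toℕ i))

_^^_ : Series → ℕ → Series
A ^^ zero  = 𝟙
A ^^ suc m = A ⊛ A ^^ m

-- Long division by a series with constant term 1:
-- if X = x₀ + q X′ and A = 1 + q A′, then X / A = x₀ + q (X′ - x₀ A′) / A.
-- The result is a quotient only when A 0 ≡ 1; see ÷-⊛.
_÷_ : Series → Series → Series
(X ÷ A) zero    = X 0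
(X ÷ A) (suc n) = ((λ m → X (suc m) - X 0 * A (suc m)) ÷ A) n

-- ∏_{1 ≤ n ≤ N} (1 - q^{kn})
f-partial : ℕ → ℕ → Series
f-partial k zero    = 𝟙
f-partial k (suc N) = (𝟙 ⊖ q^ (k ℕ.* suc N)) ⊛ f-partial k N

-- The infinite product ∏_{n ≥ 1} (1 - q^{kn}): for k ≥ 1 the factors with
-- n > m do not affect the coefficient of q^m; see f-stable.
f : (k : ℕ) .{{_ : NonZero k}} → Series
f k m = f-partial k m m

-- Σ a c n qⁿ = 1 / (f₁ f₂^{c-1}); see a-generating.
a : (c : ℕ) .{{_ : NonZero c}} → ℕ → ℤ
a c = 𝟙 ÷ (f 1 ⊛ f 2 ^^ pred c)


÷-⊛ : ∀ X A → A 0 ≡ 1ℤ → ∀ n → ((X ÷ A) ⊛ A) n ≡ X n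
÷-⊛ X A A₀ zero = begin
  X 0 * A 0 + 0ℤ  ≡⟨ ℤ.+-identityʳ _ ⟩
  X 0 * A 0       ≡⟨ cong (X 0 *_) A₀ ⟩
  X 0 * 1ℤ        ≡⟨ ℤ.*-identityʳ _ ⟩
  X 0             ∎
  where open ≡-Reasoning
÷-⊛ X A A₀ (suc n) = begin
  X 0 * A (suc n) + (X″ ÷ A ⊛ A) n
    ≡⟨ cong (λ t → X 0 * A (suc n) + t) (÷-⊛ X″ A A₀ n) ⟩
  X 0 * A (suc n) + (X (suc n) - X 0 * A (suc n))
    ≡⟨ cancel (X 0 * A (suc n)) (X (suc n)) ⟩
  X (suc n) ∎
  where
  open ≡-Reasoning
  X″ : Series
  X″ m = X (suc m) - X 0 * A (suc m)
  cancel : ∀ u v → u + (v - u) ≡ v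
  cancel = solve-∀

private
  sum-zero : ∀ {n} (t : Fin n → ℤ) → (∀ i → t i ≡ 0ℤ) → sum t ≡ 0ℤ
  sum-zero {n} t t≡0 = trans (sum-cong-≗ t≡0) (sum-replicate-zero n)

  q^-< : ∀ {m n} → n < m → (q^ m) n ≡ 0ℤ
  q^-< {m} {n} n<m =
    cong (if_then 1ℤ else 0ℤ) (dec-false (m ℕ.≟ n) (ℕ.>⇒≢ n<m))

  1-q^-⊛ : ∀ m A {n} → n < m → ((𝟙 ⊖ q^ m) ⊛ A) n ≡ A n
  1-q^-⊛ (suc m) A {n} n<m = begin
    1ℤ * A n + rest  ≡⟨ cong₂ _+_ (ℤ.*-identityˡ (A n)) (rest≡0 n n<m) ⟩
    A n + 0ℤ         ≡⟨ ℤ.+-identityʳ (A n) ⟩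
    A n              ∎
    where
    open ≡-Reasoning
    term : ∀ n → Fin n → ℤ
    term n i = (𝟙 ⊖ q^ suc m) (suc (toℕ i)) * A (n ∸ suc (toℕ i))
    rest = sum (term n)
    rest≡0 : ∀ n → n < suc m → sum (term n) ≡ 0ℤ
    rest≡0 n n<m = sum-zero (term n) λ i →
      cong (λ t → (0ℤ - t) * A (n ∸ suc (toℕ i)))
           (q^-< (ℕ.≤-<-trans (toℕ<n i) n<m))

f-stable : ∀ k .{{_ : NonZero k}} {m N} → m ≤ N → f-partial k N m ≡ f k m
f-stable k {m} m≤N = go (ℕ.≤⇒≤′ m≤N)
  where
  go : ∀ {N} → m ≤′ N → f-partial k N m ≡ f k m
  go ≤′-refl = refl
  go (≤′-step {N} m≤′N) =
    trans (1-q^-⊛ (k ℕ.* suc N) (f-partial k N)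
             (ℕ.<-≤-trans (s≤s (ℕ.≤′⇒≤ m≤′N)) (ℕ.m≤n*m (suc N) k)))
          (go m≤′N)

private
  ^^-0 : ∀ A → A 0 ≡ 1ℤ → ∀ m → (A ^^ m) 0 ≡ 1ℤ
  ^^-0 A A₀ zero    = refl
  ^^-0 A A₀ (suc m) = cong₂ (λ x y → x * y + 0ℤ) A₀ (^^-0 A A₀ m)

a-generating : ∀ c .{{_ : NonZero c}} n →
               (a c ⊛ (f 1 ⊛ f 2 ^^ pred c)) n ≡ 𝟙 n
a-generating c = ÷-⊛ 𝟙 (f 1 ⊛ f 2 ^^ pred c)
  (cong (λ y → 1ℤ * y + 0ℤ) (^^-0 (f 2) refl (pred c)))

{-# OPTIONS --safe #-}

-- Write f_k = ∏ (1 - q^{kn}) and p = c + 6.  Then Σ a_c(n) qⁿ = 1 / (f₁ f₂^{p-7}) ≡ (f₂⁷ / f₁) / f₂(q^p)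
-- modulo p, so everything depends on the weight 3 form f₂⁷ / f₁, which has complex multiplication by ℚ(i).
-- Concretely, with θ = q d/dq and F = f₁,
--   F(q) θ(F(-q)) - F(-q) θ(F(q)) = 2 q f₄⁷ / f₂ = 2 q (f₂⁷ / f₁)(q²).
-- Dividing by F(q) F(-q), the left side becomes the Lambert series 2 Σ m q^m / (1 - q^{2m}) over odd m, and
-- the identity reduces to Σ m q^m / (1 - q^{2m}) = q f₄⁸ / f₂⁴, a case of the ₆φ₅ summation proved by a
-- Wilf–Zeilberger pair.  By the pentagonal number theorem the left side is a sum over i + j = n with 24i + 1 = u²
-- and 24j + 1 = v² of terms ±(j - i) qⁿ.  If p ∣ 24n + 2 = u² + v² and p ≡ 3 (mod 4), then p divides u and v,
-- hence j - i.
-- All identities are proved in ℤ[q] / (p, q^M), where infinite sums and products are finite and 1 - q^m (m ≥ 1)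
-- is a unit.

module Submission where

open import Algebra.Bundles using (CommutativeRing; RawRing)
open import Algebra.Solver.Ring.AlmostCommutativeRing using (fromCommutativeRing; _-Raw-AlmostCommutative⟶_)
open import Algebra.Structures using (IsCommutativeRing)
open import Data.Fin.Base using (zero; suc; toℕ; fromℕ; inject₁)
open import Data.Fin.Properties using (toℕ<n; toℕ-fromℕ; toℕ-inject₁)
open import Data.Integer.Base as ℤ using (ℤ; 0ℤ; 1ℤ; +_)
open import Data.Integer.Divisibility using () renaming (_∣_ to _∣ᵤ_)
import Data.Integer.Divisibility.Signed as ℤ
import Data.Integer.Properties as ℤ
import Data.Integer.Tactic.RingSolver as ℤSolver
import Data.Maybe.Base as Maybe
open import Data.Nat.Base as ℕ using (ℕ; zero; suc; _≤_; _<_; z≤n; s≤s)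
open import Data.Nat.Combinatorics as ℕ using (nC1≡n; nCn≡1; k>n⇒nCk≡0; nCk+nC[k+1]≡[n+1]C[k+1])
import Data.Nat.Divisibility as ℕ
open import Data.Nat.Induction using (<-rec)
open import Data.Nat.Primality using (Prime; prime?; ¬prime[0]; prime⇒nonZero; euclidsLemma)
import Data.Nat.Properties as ℕ
import Data.Nat.Tactic.RingSolver as ℕSolver
open import Data.Product.Base using (_,_; ∃-syntax)
open import Data.Sum.Base using (_⊎_; inj₁; inj₂; [_,_]′)
open import Level using (0ℓ)
open import Relation.Binary.PropositionalEquality as ≡ using (_≡_; _≢_)
open import Relation.Nullary.Decidable using (dec⇒maybe; from-yes; yes; no)
open import Relation.Nullary.Negation using (contradiction; ¬_)

-- The Wronskian of F(q) and F(-q) changes sign under q ↦ -q, so it is q times a series in q². This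
-- is why the generating function enters in the variable q², through `dilate`, and why a_c(n) is
-- read off at exponent 2n + 1. The number 7 is 3 + 4: three factors f₂ contribute f₄³, and the
-- Lambert series contributes f₄⁴. The ₆φ₅ case has base y = q⁴, b = c = d = x = q² and a = y^{k+1}.
-- Its product side is (y; y)_∞⁴ / (x; y)_∞⁴ times factors that are finite products depending on k
-- alone. Dividing by these makes the sum over n independent of k, and this invariance is what the
-- pair proves. At k = 0 the sum is the Lambert series; for large k only the term n = 0 survives.
-- The product identities hold over ℤ already, but p is built into the ring from the start, so that
-- the same ring also carries the Frobenius map.

ℤ-rawRing : RawRing 0ℓ 0ℓ
ℤ-rawRing = CommutativeRing.rawRing ℤ.+-*-commutativeRing

-- Pentagonal exponents and divisibility of binomial coefficients.

triangle : ℕ → ℕ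
triangle zero    = 0
triangle (suc m) = suc m ℕ.+ triangle m

2*triangle : ∀ m → 2 ℕ.* triangle m ≡ m ℕ.* suc m
2*triangle zero    = ≡.refl
2*triangle (suc m) = ≡.trans (ℕ.*-distribˡ-+ 2 (suc m) (triangle m))
  (≡.trans (≡.cong (2 ℕ.* suc m ℕ.+_) (2*triangle m)) (ring₁ m))
  where
  ring₁ : ∀ m → 2 ℕ.* suc m ℕ.+ m ℕ.* suc m ≡ suc m ℕ.* suc (suc m)
  ring₁ = ℕSolver.solve-∀

-- Since 24 `triangle m` = 12m(m + 1), the hypothesis can be met by a polynomial identity in m,
-- which the ring solver checks without unfolding `triangle`.
pentagonal-square : ∀ m e u → u ℕ.* u ≡ 12 ℕ.* (m ℕ.* suc m) ℕ.+ (24 ℕ.* e ℕ.+ 1) → u ℕ.* u ≡ 24 ℕ.* (triangle m ℕ.+ e) ℕ.+ 1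
pentagonal-square m e u eq = ≡.trans eq (≡.trans
  (≡.cong (λ t → 12 ℕ.* t ℕ.+ (24 ℕ.* e ℕ.+ 1)) (≡.sym (2*triangle m))) (ring₂ (triangle m) e))
  where
  ring₂ : ∀ t e → 12 ℕ.* (2 ℕ.* t) ℕ.+ (24 ℕ.* e ℕ.+ 1) ≡ 24 ℕ.* (t ℕ.+ e) ℕ.+ 1
  ring₂ = ℕSolver.solve-∀

absorption : ∀ n k → suc k ℕ.* (suc n ℕ.C suc k) ≡ suc n ℕ.* (n ℕ.C k)
absorption zero    zero    = ≡.refl
absorption zero    (suc k) = ≡.trans
  (≡.cong (suc (suc k) ℕ.*_) (k>n⇒nCk≡0 {1} {suc (suc k)} (s≤s (s≤s z≤n))))
  (≡.trans (ℕ.*-zeroʳ (suc (suc k))) (≡.sym (≡.cong (1 ℕ.*_) (k>n⇒nCk≡0 {0} {suc k} (s≤s z≤n)))))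
absorption (suc n) zero    = ≡.trans (ℕ.*-identityˡ _) (≡.trans (nC1≡n (suc (suc n))) (≡.sym (ℕ.*-identityʳ _)))
absorption (suc n) (suc k) = begin
  suc (suc k) ℕ.* (suc (suc n) ℕ.C suc (suc k))
    ≡⟨ ≡.cong (suc (suc k) ℕ.*_) (nCk+nC[k+1]≡[n+1]C[k+1] (suc n) (suc k)) ⟨
  suc (suc k) ℕ.* (a ℕ.+ (suc n ℕ.C suc (suc k)))
    ≡⟨ ℕ.*-distribˡ-+ (suc (suc k)) a _ ⟩
  suc (suc k) ℕ.* a ℕ.+ suc (suc k) ℕ.* (suc n ℕ.C suc (suc k))
    ≡⟨ ≡.cong₂ (λ i j → a ℕ.+ i ℕ.+ j) (absorption n k) (absorption n (suc k)) ⟩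
  a ℕ.+ suc n ℕ.* (n ℕ.C k) ℕ.+ suc n ℕ.* (n ℕ.C suc k)
    ≡⟨ ℕ.+-assoc a _ _ ⟩
  a ℕ.+ (suc n ℕ.* (n ℕ.C k) ℕ.+ suc n ℕ.* (n ℕ.C suc k))
    ≡⟨ ≡.cong (a ℕ.+_) (ℕ.*-distribˡ-+ (suc n) (n ℕ.C k) (n ℕ.C suc k)) ⟨
  a ℕ.+ suc n ℕ.* ((n ℕ.C k) ℕ.+ (n ℕ.C suc k))
    ≡⟨ ≡.cong (λ i → a ℕ.+ suc n ℕ.* i) (nCk+nC[k+1]≡[n+1]C[k+1] n k) ⟩
  suc (suc n) ℕ.* (suc n ℕ.C suc k) ∎
  where
  open ≡.≡-Reasoning
  a = suc n ℕ.C suc k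

-- By `absorption` the prime divides k + 1 times the binomial coefficient, and it cannot divide k +
-- 1, which is smaller.
prime∣binomial : ∀ {n k} → Prime (suc n) → suc k < suc n → suc n ℕ.∣ suc n ℕ.C suc k
prime∣binomial {n} {k} n+1-prime k<n
  with euclidsLemma (suc k) (suc n ℕ.C suc k) n+1-prime
         (≡.subst (suc n ℕ.∣_) (≡.sym (absorption n k)) (ℕ.m∣m*n (n ℕ.C k)))
... | inj₁ n+1∣k+1 = contradiction n+1∣k+1 (ℕ.>⇒∤ k<n)
... | inj₂ n+1∣C   = n+1∣C

module ProductIdentities
  (R : CommutativeRing 0ℓ 0ℓ)
  (ι : ℤ-rawRing -Raw-AlmostCommutative⟶ fromCommutativeRing R)
  where

  open CommutativeRing R hiding (zero)
  open import Algebra.Properties.Ring ring using (-0#≈0#)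
  open import Algebra.Properties.CommutativeSemiring.Exp commutativeSemiring
  open import Algebra.Properties.Semiring.Mult semiring using (_×_; ×-assocˡ; ×-congʳ; ×-assoc-*; ×-homo-+; ×1-homo-*)
  import Algebra.Properties.CommutativeSemiring.Binomial commutativeSemiring as Binomial
  import Algebra.Properties.Semiring.Sum semiring as Σ
  open import Relation.Binary.Reasoning.Setoid setoid
  open _-Raw-AlmostCommutative⟶_ ι using (⟦_⟧)
  -- In the solver calls, `1#` is written as the zeroth power of a variable: a constant would be
  -- read as `⟦ 1ℤ ⟧`, which is only `≈` to `1#`.
  open import Algebra.Solver.Ring ℤ-rawRing (fromCommutativeRing R) ι
    (λ i j → Maybe.map (λ i≡j → reflexive (≡.cong ⟦_⟧ i≡j)) (dec⇒maybe (i ℤ.≟ j)))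
    using (solve; _:+_; _:*_; _:-_; :-_; _:^_; _:=_)

  -- Finite sums and products.

  sum prod : (ℕ → Carrier) → ℕ → Carrier
  sum f zero    = 0#
  sum f (suc n) = f n + sum f n
  prod f zero    = 1#
  prod f (suc n) = f n * prod f n

  sum-cong : ∀ {f g} → (∀ i → f i ≈ g i) → ∀ n → sum f n ≈ sum g n
  sum-cong f≈g zero    = refl
  sum-cong f≈g (suc n) = +-cong (f≈g n) (sum-cong f≈g n)

  prod-cong : ∀ {f g} → (∀ i → f i ≈ g i) → ∀ n → prod f n ≈ prod g n
  prod-cong f≈g zero    = refl
  prod-cong f≈g (suc n) = *-cong (f≈g n) (prod-cong f≈g n)

  *-distribˡ-sum : ∀ c f n → c * sum f n ≈ sum (λ i → c * f i) n
  *-distribˡ-sum c f zero    = zeroʳ c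
  *-distribˡ-sum c f (suc n) = trans (distribˡ c (f n) (sum f n)) (+-congˡ (*-distribˡ-sum c f n))

  sum-+ : ∀ f g n → sum (λ i → f i + g i) n ≈ sum f n + sum g n
  sum-+ f g zero    = sym (+-identityˡ 0#)
  sum-+ f g (suc n) = trans (+-congˡ (sum-+ f g n))
    (solve 4 (λ a b c d → (a :+ b) :+ (c :+ d) := (a :+ c) :+ (b :+ d)) refl (f n) (g n) (sum f n) (sum g n))

  sum-minus : ∀ f g n → sum f n - sum g n ≈ sum (λ i → f i - g i) n
  sum-minus f g zero    = -‿inverseʳ 0#
  sum-minus f g (suc n) = trans
    (solve 4 (λ a b c d → (a :+ b) :- (c :+ d) := (a :- c) :+ (b :- d)) refl (f n) (sum f n) (g n) (sum g n))
    (+-congˡ (sum-minus f g n))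

  sum-0 : ∀ f → (∀ i → f i ≈ 0#) → ∀ n → sum f n ≈ 0#
  sum-0 f f≈0 zero    = refl
  sum-0 f f≈0 (suc n) = trans (+-cong (f≈0 n) (sum-0 f f≈0 n)) (+-identityˡ 0#)

  sum-swap : ∀ (f : ℕ → ℕ → Carrier) m n → sum (λ i → sum (f i) n) m ≈ sum (λ j → sum (λ i → f i j) m) n
  sum-swap f zero    n = sym (sum-0 (λ _ → 0#) (λ _ → refl) n)
  sum-swap f (suc m) n = trans (+-congˡ (sum-swap f m n)) (sym (sum-+ (f m) _ n))

  sum-head : ∀ f → (∀ i → f (suc i) ≈ 0#) → ∀ n → sum f (suc n) ≈ f 0
  sum-head f f≈0 zero    = +-identityʳ _
  sum-head f f≈0 (suc n) = trans (+-cong (f≈0 n) (sum-head f f≈0 n)) (+-identityˡ _)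

  telescope : ∀ f (g : ℕ → Carrier) → (∀ i → f i ≈ g (suc i) - g i) → ∀ n → sum f n ≈ g n - g 0
  telescope f g eq zero    = sym (-‿inverseʳ (g 0))
  telescope f g eq (suc n) = trans (+-cong (eq n) (telescope f g eq n))
    (solve 3 (λ a b c → (a :- b) :+ (b :- c) := a :- c) refl (g (suc n)) (g n) (g 0))

  prod-* : ∀ f g n → prod (λ i → f i * g i) n ≈ prod f n * prod g n
  prod-* f g zero    = sym (*-identityˡ 1#)
  prod-* f g (suc n) = trans (*-congˡ (prod-* f g n))
    (solve 4 (λ a b c d → (a :* b) :* (c :* d) := (a :* c) :* (b :* d)) refl (f n) (g n) (prod f n) (prod g n))

  prod-1 : ∀ f → (∀ i → f i ≈ 1#) → ∀ n → prod f n ≈ 1#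
  prod-1 f f≈1 zero    = refl
  prod-1 f f≈1 (suc n) = trans (*-cong (f≈1 n) (prod-1 f f≈1 n)) (*-identityˡ 1#)

  prod-inverse : ∀ f g → (∀ i → f i * g i ≈ 1#) → ∀ n → prod f n * prod g n ≈ 1#
  prod-inverse f g fg≈1 n = trans (sym (prod-* f g n)) (prod-1 _ fg≈1 n)

  prod-parity : ∀ f n → prod f (2 ℕ.* n) ≈ prod (λ i → f (2 ℕ.* i)) n * prod (λ i → f (suc (2 ℕ.* i))) n
  prod-parity f zero = sym (*-identityˡ 1#)
  prod-parity f (suc n) rewrite ℕ.+-suc n (n ℕ.+ 0) = trans (*-congˡ (*-congˡ (prod-parity f n)))
    (solve 4 (λ a b c d → a :* (b :* (c :* d)) := (b :* c) :* (a :* d)) refl _ _ _ _)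

  prod-stable : ∀ f {m} → (∀ i → m ≤ i → f i ≈ 1#) → ∀ {n} → m ≤ n → prod f n ≈ prod f m
  prod-stable f {m} f≈1 m≤n = go (ℕ.≤⇒≤′ m≤n)
    where
    go : ∀ {n} → m ℕ.≤′ n → prod f n ≈ prod f m
    go ℕ.≤′-refl       = refl
    go (ℕ.≤′-step m≤n) = trans (*-cong (f≈1 _ (ℕ.≤′⇒≤ m≤n)) (go m≤n)) (*-identityˡ _)

  0*≈0 : ∀ {a} b → a ≈ 0# → a * b ≈ 0#
  0*≈0 b a≈0 = trans (*-congʳ a≈0) (zeroˡ b)

  minus-zero : ∀ {a b} → b ≈ 0# → a - b ≈ a
  minus-zero {a} b≈0 = trans (+-congˡ (trans (-‿cong b≈0) -0#≈0#)) (+-identityʳ a)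

  x-y≈0⇒x≈y : ∀ {x y} → x - y ≈ 0# → x ≈ y
  x-y≈0⇒x≈y {x} {y} x-y≈0 = begin
    x           ≈⟨ solve 2 (λ x y → x := (x :- y) :+ y) refl x y ⟩
    (x - y) + y ≈⟨ +-congʳ x-y≈0 ⟩
    0# + y      ≈⟨ +-identityˡ y ⟩
    y           ∎

  geometric : ∀ z n → (1# - z) * sum (z ^_) n ≈ 1# - z ^ n
  geometric z zero    = trans (zeroʳ _) (sym (-‿inverseʳ 1#))
  geometric z (suc n) = begin
    (1# - z) * (z ^ n + sum (z ^_) n)              ≈⟨ distribˡ _ _ _ ⟩
    (1# - z) * z ^ n + (1# - z) * sum (z ^_) n     ≈⟨ +-congˡ (geometric z n) ⟩
    (1# - z) * z ^ n + (1# - z ^ n)                ≈⟨ solve 2 (λ z w → (z :^ 0 :- z) :* w :+ (z :^ 0 :- w) := z :^ 0 :- z :* w) refl z (z ^ n) ⟩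
    1# - z * z ^ n                                 ∎

  -- Products in a nilpotent variable.

  module Nilpotent (x : Carrier) (M : ℕ) (x^M≈0 : x ^ M ≈ 0#) where

    multiple-nilpotent : ∀ w → (x * w) ^ M ≈ 0#
    multiple-nilpotent w = trans (^-distrib-* x w M) (0*≈0 _ x^M≈0)

    power-vanishes : ∀ {m} → M ≤ m → x ^ m ≈ 0#
    power-vanishes {m} M≤m = begin
      x ^ m                    ≈⟨ ^-congʳ x (≡.sym (ℕ.m+[n∸m]≡n M≤m)) ⟩
      x ^ (M ℕ.+ (m ℕ.∸ M))    ≈⟨ ^-homo-* x M (m ℕ.∸ M) ⟩
      x ^ M * x ^ (m ℕ.∸ M)    ≈⟨ 0*≈0 _ x^M≈0 ⟩
      0#                       ∎

    -- Every unit that must be inverted is brought to the form `1# - x * w`; as `x * w` is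
    -- nilpotent, a geometric sum of M terms inverts it exactly.
    inv : Carrier → Carrier
    inv w = sum ((x * w) ^_) M

    inv-inverse : ∀ w → (1# - x * w) * inv w ≈ 1#
    inv-inverse w = trans (geometric (x * w) M) (minus-zero (multiple-nilpotent w))

    euler : ℕ → Carrier
    euler = prod (λ i → 1# - x ^ suc i)

    -- Euler's pentagonal series.

    private
      -- `c s` is (-1)ˢ x^{s(s+1)/2} / (x; x)ₛ. By Euler's expansion the full series Σ `c s` x^{ns}
      -- is (x^{n+1}; x)_∞, so that multiplied by `euler n` it gives (x; x)_∞ for every n; `S n`
      -- below cuts it off after s = n.
      c : ℕ → Carrier
      c zero    = 1#
      c (suc s) = - (x ^ suc s * inv (x ^ s)) * c s

      term : ℕ → ℕ → Carrier
      term n s = c s * (x ^ n) ^ s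

      d : ℕ → Carrier
      d m = euler m * c m

      -- Shanks: S n = Σ_{s ≤ n} (-1)ˢ ((x)ₙ / (x)ₛ) x^{sn + s(s+1)/2} is a partial sum of the
      -- pentagonal series, and only its term s = 0 survives when xⁿ = 0.
      S : ℕ → Carrier
      S n = euler n * sum (term n) (suc n)

      -- The new factor 1 - x^{m+1} of `euler` cancels the new denominator of `c`, so `d m` is the
      -- signed monomial (-1)ᵐ x^{m(m+1)/2}.
      d-suc : ∀ m → d (suc m) ≈ - (x ^ suc m * d m)
      d-suc m = begin
        ((1# - X) * euler m) * (- (X * i) * c m)
          ≈⟨ solve 4 (λ X i e c → ((X :^ 0 :- X) :* e) :* (:- (X :* i) :* c) := (:- (X :* (e :* c))) :* ((X :^ 0 :- X) :* i)) refl X i (euler m) (c m) ⟩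
        - (X * d m) * ((1# - X) * i)  ≈⟨ *-congˡ (inv-inverse (x ^ m)) ⟩
        - (X * d m) * 1#              ≈⟨ *-identityʳ _ ⟩
        - (X * d m)                   ∎
        where
        X = x ^ suc m
        i = inv (x ^ m)

      -- A telescoping certificate in s for `(1# - x ^ suc n) * term (suc n) s - term n s`. It
      -- vanishes at s = 0, so after summation only the upper end remains.
      g : ℕ → ℕ → Carrier
      g n s = term n s * (1# - x ^ s)

      g-suc : ∀ n s → g n (suc s) ≈ - (term n s * (x ^ s * x ^ suc n))
      g-suc n s = begin
        ((- ((x * Y) * i) * c s) * (Z * w)) * (1# - x * Y)
          ≈⟨ solve 6 (λ x Y i c Z w → ((:- ((x :* Y) :* i) :* c) :* (Z :* w)) :* (x :^ 0 :- x :* Y)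
               := (:- ((c :* w) :* (Y :* (x :* Z)))) :* ((x :^ 0 :- x :* Y) :* i)) refl x Y i (c s) Z w ⟩
        - (term n s * (Y * (x * Z))) * ((1# - x * Y) * i)  ≈⟨ *-congˡ (inv-inverse Y) ⟩
        - (term n s * (Y * (x * Z))) * 1#                  ≈⟨ *-identityʳ _ ⟩
        - (term n s * (Y * (x * Z)))                       ∎
        where
        Y = x ^ s
        Z = x ^ n
        i = inv Y
        w = Z ^ s

      S-step : ∀ n s → (1# - x ^ suc n) * term (suc n) s - term n s ≈ g n (suc s) - g n s
      S-step n s = begin
        (1# - X) * (c s * (x * x ^ n) ^ s) - term n s
          ≈⟨ +-congʳ (*-congˡ (*-congˡ (^-distrib-* x (x ^ n) s))) ⟩
        (1# - X) * (c s * (Y * w)) - c s * w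
          ≈⟨ solve 4 (λ X c Y w → (X :^ 0 :- X) :* (c :* (Y :* w)) :- c :* w
               := (:- ((c :* w) :* (Y :* X))) :- (c :* w) :* (X :^ 0 :- Y)) refl X (c s) Y w ⟩
        - (term n s * (Y * X)) - g n s
          ≈⟨ +-congʳ (g-suc n s) ⟨
        g n (suc s) - g n s ∎
        where
        X = x ^ suc n
        Y = x ^ s
        w = (x ^ n) ^ s

      -- The two increments are (-1)ᵐ x^{m(3m+1)/2} and (-1)ᵐ x^{m(3m-1)/2} with m = n + 1. The
      -- first is the new summand s = n + 1, the second is what the telescoping leaves behind.
      S-suc : ∀ n → S (suc n) ≈ S n + (d (suc n) * (x ^ suc n) ^ suc n - d n * ((x ^ n) ^ n * (x ^ n * x ^ suc n)))
      S-suc n = begin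
        ((1# - X) * e) * (c (suc n) * w + Σ′)
          ≈⟨ solve 6 (λ X e c w s t → ((X :^ 0 :- X) :* e) :* (c :* w :+ s)
               := e :* t :+ ((((X :^ 0 :- X) :* e) :* c) :* w :+ e :* ((X :^ 0 :- X) :* s :- t))) refl X e (c (suc n)) w Σ′ Σ″ ⟩
        S n + (d (suc n) * w + e * ((1# - X) * Σ′ - Σ″))
          ≈⟨ +-congˡ (+-congˡ (*-congˡ difference)) ⟩
        S n + (d (suc n) * w + e * (- (term n n * (x ^ n * X))))
          ≈⟨ +-congˡ (+-congˡ (solve 4 (λ e c v y → e :* (:- ((c :* v) :* y)) := :- ((e :* c) :* (v :* y))) refl e (c n) ((x ^ n) ^ n) (x ^ n * X))) ⟩
        S n + (d (suc n) * w - d n * ((x ^ n) ^ n * (x ^ n * X))) ∎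
        where
        X = x ^ suc n
        e = euler n
        w = (x ^ suc n) ^ suc n
        Σ′ = sum (term (suc n)) (suc n)
        Σ″ = sum (term n) (suc n)
        difference : (1# - X) * Σ′ - Σ″ ≈ - (term n n * (x ^ n * X))
        difference = begin
          (1# - X) * Σ′ - Σ″
            ≈⟨ +-congʳ (*-distribˡ-sum _ _ (suc n)) ⟩
          sum (λ s → (1# - X) * term (suc n) s) (suc n) - Σ″
            ≈⟨ sum-minus _ (term n) (suc n) ⟩
          sum (λ s → (1# - X) * term (suc n) s - term n s) (suc n)
            ≈⟨ telescope _ (g n) (S-step n) (suc n) ⟩
          g n (suc n) - g n 0
            ≈⟨ +-congˡ (-‿cong (trans (*-congˡ (-‿inverseʳ 1#)) (zeroʳ _))) ⟩
          g n (suc n) - 0#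
            ≈⟨ minus-zero refl ⟩
          g n (suc n)
            ≈⟨ g-suc n n ⟩
          - (term n n * (x ^ n * X)) ∎

      euler≈S : ∀ {n} → M ≤ n → euler n ≈ S n
      euler≈S {n} M≤n = begin
        euler n           ≈⟨ *-identityʳ _ ⟨
        euler n * 1#      ≈⟨ *-congˡ (*-identityʳ 1#) ⟨
        euler n * (1# * (x ^ n) ^ 0)
          ≈⟨ *-congˡ (sum-head (term n) (λ s → trans (*-congˡ (0*≈0 _ (power-vanishes M≤n))) (zeroʳ _)) n) ⟨
        S n ∎

    -- The final argument uses only where the nonzero coefficients of the Euler product lie, so
    -- signs are forgotten here: `𝒫` is any property closed under sums and negation that holds for
    -- x^e whenever 24e + 1 is a square.
    module PentagonalSupport
      (𝒫 : Carrier → Set)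
      (𝒫-resp-≈ : ∀ {a b} → a ≈ b → 𝒫 a → 𝒫 b)
      (𝒫-+ : ∀ {a b} → 𝒫 a → 𝒫 b → 𝒫 (a + b))
      (𝒫-neg : ∀ {a} → 𝒫 a → 𝒫 (- a))
      (𝒫-power : ∀ e u → u ℕ.* u ≡ 24 ℕ.* e ℕ.+ 1 → 𝒫 (x ^ e))
      where

      private
        d-power : ∀ m e → 𝒫 (x ^ (triangle m ℕ.+ e)) → 𝒫 (d m * x ^ e)
        d-power zero    e h = 𝒫-resp-≈ (solve 1 (λ y → y := ((y :^ 0) :* (y :^ 0)) :* y) refl (x ^ e)) h
        d-power (suc m) e h = 𝒫-resp-≈ (sym eq) (𝒫-neg (d-power m (suc m ℕ.+ e)
          (𝒫-resp-≈ (^-congʳ x (ring₂ m (triangle m) e)) h)))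
          where
          ring₂ : ∀ m t e → suc m ℕ.+ t ℕ.+ e ≡ t ℕ.+ (suc m ℕ.+ e)
          ring₂ = ℕSolver.solve-∀
          eq : d (suc m) * x ^ e ≈ - (d m * x ^ (suc m ℕ.+ e))
          eq = begin
            d (suc m) * x ^ e               ≈⟨ *-congʳ (d-suc m) ⟩
            - (x ^ suc m * d m) * x ^ e     ≈⟨ solve 3 (λ a d b → (:- (a :* d)) :* b := :- (d :* (a :* b))) refl (x ^ suc m) (d m) (x ^ e) ⟩
            - (d m * (x ^ suc m * x ^ e))   ≈⟨ -‿cong (*-congˡ (^-homo-* x (suc m) e)) ⟨
            - (d m * x ^ (suc m ℕ.+ e))     ∎

        d-pentagonal : ∀ m e u → u ℕ.* u ≡ 12 ℕ.* (m ℕ.* suc m) ℕ.+ (24 ℕ.* e ℕ.+ 1) → 𝒫 (d m * x ^ e)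
        d-pentagonal m e u eq = d-power m e (𝒫-power (triangle m ℕ.+ e) u (pentagonal-square m e u eq))

        𝒫-S : ∀ n → 𝒫 (S n)
        𝒫-S zero    = 𝒫-resp-≈ (trans (solve 1 (λ y → y :^ 0 := (y :^ 0) :* ((y :^ 0) :* (y :^ 0))) refl x) (*-congˡ (sym (+-identityʳ _)))) (𝒫-power 0 1 ≡.refl)
        -- For m = n + 1 the exponents are m(3m ± 1)/2, and 24 times such a number plus 1 is (6m ±
        -- 1)²; hence the roots 6n + 7 and 6n + 5.
        𝒫-S (suc n) = 𝒫-resp-≈ (sym (S-suc n)) (𝒫-+ (𝒫-S n) (𝒫-+
          (𝒫-resp-≈ (*-congˡ (sym (^-assocʳ x (suc n) (suc n))))
            (d-pentagonal (suc n) (suc n ℕ.* suc n) (6 ℕ.* n ℕ.+ 7) (ring₃ n)))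
          (𝒫-neg (𝒫-resp-≈ (*-congˡ (sym powers))
            (d-pentagonal n (n ℕ.* n ℕ.+ (n ℕ.+ suc n)) (6 ℕ.* n ℕ.+ 5) (ring₄ n))))))
          where
          ring₃ : ∀ n → (6 ℕ.* n ℕ.+ 7) ℕ.* (6 ℕ.* n ℕ.+ 7) ≡ 12 ℕ.* (suc n ℕ.* suc (suc n)) ℕ.+ (24 ℕ.* (suc n ℕ.* suc n) ℕ.+ 1)
          ring₃ = ℕSolver.solve-∀
          ring₄ : ∀ n → (6 ℕ.* n ℕ.+ 5) ℕ.* (6 ℕ.* n ℕ.+ 5) ≡ 12 ℕ.* (n ℕ.* suc n) ℕ.+ (24 ℕ.* (n ℕ.* n ℕ.+ (n ℕ.+ suc n)) ℕ.+ 1)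
          ring₄ = ℕSolver.solve-∀
          powers : (x ^ n) ^ n * (x ^ n * x ^ suc n) ≈ x ^ (n ℕ.* n ℕ.+ (n ℕ.+ suc n))
          powers = begin
            (x ^ n) ^ n * (x ^ n * x ^ suc n)         ≈⟨ *-cong (^-assocʳ x n n) (sym (^-homo-* x n (suc n))) ⟩
            x ^ (n ℕ.* n) * x ^ (n ℕ.+ suc n)         ≈⟨ ^-homo-* x (n ℕ.* n) (n ℕ.+ suc n) ⟨
            x ^ (n ℕ.* n ℕ.+ (n ℕ.+ suc n))           ∎

      pentagonal : ∀ {n} → M ≤ n → 𝒫 (euler n)
      pentagonal {n} M≤n = 𝒫-resp-≈ (sym (euler≈S M≤n)) (𝒫-S n)

    -- The Lambert series as a product: a case of the ₆φ₅ summation.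

    private
      y : Carrier
      y = x * x

    odd-factor even-factor odd-inverse even-inverse : ℕ → Carrier
    odd-factor n   = 1# - x * y ^ n
    even-factor n  = 1# - x * (x * y ^ n)
    odd-inverse n  = inv (y ^ n)
    even-inverse n = inv (x * y ^ n)

    O E : ℕ → Carrier
    O = prod odd-factor
    E = prod even-factor

    private
      O⁻¹ E⁻¹ : ℕ → Carrier
      O⁻¹ = prod odd-inverse
      E⁻¹ = prod even-inverse

      -- The factor pattern shared by `u`, `G` and `w`. In base y = x², `O n` is (x; y)ₙ and `E n`
      -- is (y; y)ₙ. The ₆φ₅ factor (a; y)ₙ with a = y^{k+1} is then `E (n + k)` / `E k`, and each
      -- of the three factors (ay/x; y)ₙ in its denominator is `O (suc (n + k))` / `O (suc k)`.
      shape : (t a b c d e f p : Carrier) → Carrier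
      shape t a b c d e f p = (t * (a ^ 3 * b * c ^ 3 * d * e * f ^ 3)) * p

      shape-cong : ∀ {t a b c d e f p t′ a′ b′ c′ d′ e′ f′ p′} →
        t ≈ t′ → a ≈ a′ → b ≈ b′ → c ≈ c′ → d ≈ d′ → e ≈ e′ → f ≈ f′ → p ≈ p′ →
        shape t a b c d e f p ≈ shape t′ a′ b′ c′ d′ e′ f′ p′
      shape-cong t a b c d e f p =
        *-cong (*-cong t (*-cong (*-cong (*-cong (*-cong (*-cong (^-congˡ 3 a) b) (^-congˡ 3 c)) d) e) (^-congˡ 3 f))) p

      -- A Wilf–Zeilberger pair: u (suc k) n - u k n ≈ G k (suc n) - G k n.  It specialises the
      -- one behind the ₆φ₅ summation, so that u 0 is the Lambert series and u ∞ 0 the product.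
      u G w : ℕ → ℕ → Carrier
      u k n = shape ((x * y ^ k) ^ n) (E k) (E (n ℕ.+ k)) (O n) (E⁻¹ n) (O⁻¹ k) (O⁻¹ (suc (n ℕ.+ k)))
        (1# - (y ^ n * y ^ n) * (y ^ k * y))
      G k n = shape ((x * y ^ k) ^ n) (E k) (E (n ℕ.+ k)) (O n) (E⁻¹ n) (O⁻¹ (suc k)) (O⁻¹ (suc (n ℕ.+ k)))
        ((1# - y ^ n) * (1# - (y ^ k * y ^ k) * (x * y) * y ^ n))
      w k n = shape ((x * y ^ k) ^ n) (E k) (E (n ℕ.+ k)) (O n) (E⁻¹ n) (O⁻¹ (suc k)) (O⁻¹ (suc (suc (n ℕ.+ k)))) 1#

      O⁻¹-suc : ∀ n → O⁻¹ n ≈ O⁻¹ (suc n) * odd-factor n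
      O⁻¹-suc n = begin
        O⁻¹ n                                        ≈⟨ *-identityˡ _ ⟨
        1# * O⁻¹ n                                   ≈⟨ *-congʳ (inv-inverse (y ^ n)) ⟨
        (odd-factor n * odd-inverse n) * O⁻¹ n       ≈⟨ solve 3 (λ a b c → (a :* b) :* c := (b :* c) :* a) refl _ _ _ ⟩
        (odd-inverse n * O⁻¹ n) * odd-factor n       ∎

      odd-factor-+ : ∀ n k → odd-factor (suc (n ℕ.+ k)) ≈ 1# - x * (y * (y ^ n * y ^ k))
      odd-factor-+ n k = +-congˡ (-‿cong (*-congˡ (*-congˡ (^-homo-* y n k))))

      even-factor-+ : ∀ n k → even-factor (n ℕ.+ k) ≈ 1# - x * (x * (y ^ n * y ^ k))
      even-factor-+ n k = +-congˡ (-‿cong (*-congˡ (*-congˡ (^-homo-* y n k))))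

      -- All four terms of the Wilf-Zeilberger equation are `w k n` times a polynomial in x, `K` and
      -- `X`, so `WZ` comes down to one polynomial identity.
      module Step (k n : ℕ) where
        K = y ^ k
        X = y ^ n
        o o′ o″ e′ : Carrier
        o  = odd-factor n
        o′ = odd-factor k
        o″ = 1# - x * (y * (X * K))
        e′ = 1# - x * (x * (X * K))

        u≈ : u k n ≈ w k n * (o′ * o″ ^ 3 * (1# - (X * X) * (K * y)))
        u≈ = trans
          (shape-cong refl refl refl refl refl (O⁻¹-suc k)
            (trans (O⁻¹-suc (suc (n ℕ.+ k))) (*-congˡ (odd-factor-+ n k))) refl)
          (solve 10 (λ t a b c d e f p o o″ →
              (t :* (a :^ 3 :* b :* c :^ 3 :* d :* (e :* o) :* (f :* o″) :^ 3)) :* p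
            := ((t :* (a :^ 3 :* b :* c :^ 3 :* d :* e :* f :^ 3)) :* t :^ 0) :* (o :* o″ :^ 3 :* p))
            refl _ _ _ _ _ _ _ _ _ _)

        u-suc≈ : u (suc k) n ≈ w k n * (X * even-factor k ^ 3 * e′ * (1# - (X * X) * ((y * K) * y)))
        u-suc≈ = trans
          (shape-cong
            (trans (^-congˡ n (solve 3 (λ x y K → x :* (y :* K) := y :* (x :* K)) refl x y K))
              (^-distrib-* y (x * K) n))
            refl
            (trans (reflexive (≡.cong E (ℕ.+-suc n k))) (*-congʳ (even-factor-+ n k)))
            refl refl refl (reflexive (≡.cong (λ m → O⁻¹ (suc m)) (ℕ.+-suc n k))) refl)
          (solve 11 (λ X t e a e′ b c d i f p →
              ((X :* t) :* ((e :* a) :^ 3 :* (e′ :* b) :* c :^ 3 :* d :* i :* f :^ 3)) :* p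
            := ((t :* (a :^ 3 :* b :* c :^ 3 :* d :* i :* f :^ 3)) :* t :^ 0) :* (X :* e :^ 3 :* e′ :* p))
            refl _ _ _ _ _ _ _ _ _ _ _)

        G≈ : G k n ≈ w k n * (o″ ^ 3 * ((1# - X) * (1# - (K * K) * (x * y) * X)))
        G≈ = trans
          (shape-cong refl refl refl refl refl refl
            (trans (O⁻¹-suc (suc (n ℕ.+ k))) (*-congˡ (odd-factor-+ n k))) refl)
          (solve 9 (λ t a b c d e f p o″ →
              (t :* (a :^ 3 :* b :* c :^ 3 :* d :* e :* (f :* o″) :^ 3)) :* p
            := ((t :* (a :^ 3 :* b :* c :^ 3 :* d :* e :* f :^ 3)) :* t :^ 0) :* (o″ :^ 3 :* p))
            refl _ _ _ _ _ _ _ _ _)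

        G-suc≈ : G k (suc n) ≈ w k n * ((x * K) * e′ * o ^ 3 * (1# - (K * K) * (x * y) * (y * X)))
        G-suc≈ = begin
          G k (suc n)
            ≈⟨ shape-cong refl refl (*-congʳ (even-factor-+ n k)) refl refl refl refl
                 (*-congʳ (+-congˡ (-‿cong (*-assoc x x X)))) ⟩
          shape ((x * K) * (x * K) ^ n) (E k) (e′ * E (n ℕ.+ k)) (o * O n) (even-inverse n * E⁻¹ n)
            (O⁻¹ (suc k)) (O⁻¹ (suc (suc (n ℕ.+ k)))) (even-factor n * r)
            ≈⟨ solve 13 (λ s t a e′ b o c j d i f e r →
                 ((s :* t) :* (a :^ 3 :* (e′ :* b) :* (o :* c) :^ 3 :* (j :* d) :* i :* f :^ 3)) :* (e :* r)
               := (((t :* (a :^ 3 :* b :* c :^ 3 :* d :* i :* f :^ 3)) :* t :^ 0) :* (s :* e′ :* o :^ 3 :* r)) :* (e :* j))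
               refl _ _ _ _ _ _ _ _ _ _ _ _ _ ⟩
          (w k n * ((x * K) * e′ * o ^ 3 * r)) * (even-factor n * even-inverse n)
            -- The factor 1 - y^{n+1} of `G k (suc n)` cancels the new factor of `E⁻¹ (suc n)`.
            ≈⟨ *-congˡ (inv-inverse (x * X)) ⟩
          (w k n * ((x * K) * e′ * o ^ 3 * r)) * 1#
            ≈⟨ *-identityʳ _ ⟩
          w k n * ((x * K) * e′ * o ^ 3 * r) ∎
          where r = 1# - (K * K) * (x * y) * (y * X)

        WZ : u (suc k) n - u k n ≈ G k (suc n) - G k n
        WZ = begin
          u (suc k) n - u k n  ≈⟨ +-cong u-suc≈ (-‿cong u≈) ⟩
          w k n * (X * even-factor k ^ 3 * e′ * (1# - (X * X) * ((y * K) * y))) - w k n * (o′ * o″ ^ 3 * (1# - (X * X) * (K * y)))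
            ≈⟨ solve 4 (λ w X K x → let one = x :^ 0; y = x :* x; e′ = one :- x :* (x :* (X :* K)); o″ = one :- x :* (y :* (X :* K)) in
                 w :* (X :* (one :- x :* (x :* K)) :^ 3 :* e′ :* (one :- (X :* X) :* ((y :* K) :* y)))
                   :- w :* ((one :- x :* K) :* o″ :^ 3 :* (one :- (X :* X) :* (K :* y)))
               := w :* ((x :* K) :* e′ :* (one :- x :* X) :^ 3 :* (one :- (K :* K) :* (x :* y) :* (y :* X)))
                   :- w :* (o″ :^ 3 :* ((one :- X) :* (one :- (K :* K) :* (x :* y) :* X))))
               refl (w k n) X K x ⟩
          w k n * ((x * K) * e′ * o ^ 3 * (1# - (K * K) * (x * y) * (y * X))) - w k n * (o″ ^ 3 * ((1# - X) * (1# - (K * K) * (x * y) * X)))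
            ≈⟨ +-cong G-suc≈ (-‿cong G≈) ⟨
          G k (suc n) - G k n  ∎

      shape-0 : ∀ {t} a b c d e f p → t ≈ 0# → shape t a b c d e f p ≈ 0#
      shape-0 a b c d e f p t≈0 = 0*≈0 p (0*≈0 _ t≈0)

      -- `G k` vanishes at both ends of the telescoping sum: at n = 0 because of 1 - y⁰, at n = M +
      -- 1 because x yᵏ is nilpotent.
      u-sum-suc : ∀ k → sum (u (suc k)) (suc M) ≈ sum (u k) (suc M)
      u-sum-suc k = x-y≈0⇒x≈y (begin
        sum (u (suc k)) (suc M) - sum (u k) (suc M)   ≈⟨ sum-minus (u (suc k)) (u k) (suc M) ⟩
        sum (λ n → u (suc k) n - u k n) (suc M)       ≈⟨ telescope _ (G k) (λ n → Step.WZ k n) (suc M) ⟩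
        G k (suc M) - G k 0                           ≈⟨ +-cong
          (shape-0 _ _ _ _ _ _ _ (trans (*-congˡ (multiple-nilpotent (y ^ k))) (zeroʳ _)))
          (-‿cong (trans (*-congˡ (0*≈0 _ (-‿inverseʳ 1#))) (zeroʳ _))) ⟩
        0# - 0#                                       ≈⟨ -‿inverseʳ 0# ⟩
        0#                                            ∎)

      u-sum : ∀ k → sum (u k) (suc M) ≈ sum (u 0) (suc M)
      u-sum zero    = refl
      u-sum (suc k) = trans (u-sum-suc k) (u-sum k)

    -- For x = q² and m = 2n + 1 this is q^{m-1} (1 + q^{2m}) / (1 - q^{2m})².
    lambert-term : ℕ → Carrier
    lambert-term n = x ^ n * (1# + x * y ^ n) * odd-inverse n ^ 2

    private
      u-0 : ∀ n → u 0 n ≈ lambert-term n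
      u-0 n = begin
        u 0 n
          ≈⟨ shape-cong (^-congˡ n (*-identityʳ x)) refl (reflexive (≡.cong E (ℕ.+-identityʳ n))) refl refl refl
               (reflexive (≡.cong (λ m → O⁻¹ (suc m)) (ℕ.+-identityʳ n))) refl ⟩
        shape (x ^ n) 1# (E n) (O n) (E⁻¹ n) 1# (odd-inverse n * O⁻¹ n) (1# - (y ^ n * y ^ n) * (1# * y))
          ≈⟨ solve 8 (λ x t b c d i f X → let one = x :^ 0 in
               (t :* (one :^ 3 :* b :* c :^ 3 :* d :* one :* (i :* f) :^ 3)) :* (one :- (X :* X) :* (one :* (x :* x)))
             := (t :* (one :+ x :* X) :* i :^ 2) :* ((b :* d) :* (c :* f) :^ 3 :* ((one :- x :* X) :* i)))
             refl x (x ^ n) (E n) (O n) (E⁻¹ n) (odd-inverse n) (O⁻¹ n) (y ^ n) ⟩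
        lambert-term n * ((E n * E⁻¹ n) * (O n * O⁻¹ n) ^ 3 * (odd-factor n * odd-inverse n))
          ≈⟨ *-congˡ (*-cong (*-cong (prod-inverse _ _ (λ i → inv-inverse _) n)
               (^-congˡ 3 (prod-inverse _ _ (λ i → inv-inverse _) n))) (inv-inverse _)) ⟩
        lambert-term n * (1# * 1# ^ 3 * 1#)
          ≈⟨ solve 1 (λ t → t :* (t :^ 0 :* (t :^ 0) :^ 3 :* t :^ 0) := t) refl _ ⟩
        lambert-term n ∎

      -- At k = M + 1 the power yᵏ is zero, so k is as good as infinite: only n = 0 contributes, and
      -- the one surplus factor `odd-inverse k` is 1.
      u-∞ : sum (u (suc M)) (suc M) * O (suc M) ^ 4 ≈ E (suc M) ^ 4
      u-∞ = begin
        sum (u k) (suc M) * O k ^ 4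
          ≈⟨ *-congʳ (sum-head (u k) (λ i → shape-0 _ _ _ _ _ _ _ (0*≈0 _ xK≈0)) M) ⟩
        u k 0 * O k ^ 4
          ≈⟨ *-congʳ (*-congˡ (minus-zero (trans (*-congˡ (0*≈0 y K≈0)) (zeroʳ _)))) ⟩
        shape 1# (E k) (E k) 1# 1# (O⁻¹ k) (odd-inverse k * O⁻¹ k) 1# * O k ^ 4
          ≈⟨ solve 4 (λ a f i o → let one = a :^ 0 in
               ((one :* (a :^ 3 :* a :* one :^ 3 :* one :* f :* (i :* f) :^ 3)) :* one) :* o :^ 4
             := a :^ 4 :* (i :^ 3 :* (o :* f) :^ 4)) refl (E k) (O⁻¹ k) (odd-inverse k) (O k) ⟩
        E k ^ 4 * (odd-inverse k ^ 3 * (O k * O⁻¹ k) ^ 4)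
          ≈⟨ *-congˡ (*-cong (^-congˡ 3 inverse≈1) (^-congˡ 4 (prod-inverse _ _ (λ i → inv-inverse _) k))) ⟩
        E k ^ 4 * (1# ^ 3 * 1# ^ 4)
          ≈⟨ solve 1 (λ t → t :* ((t :^ 0) :^ 3 :* (t :^ 0) :^ 4) := t) refl _ ⟩
        E k ^ 4 ∎
        where
        k = suc M
        K≈0 : y ^ k ≈ 0#
        K≈0 = trans (*-congˡ (multiple-nilpotent x)) (zeroʳ y)
        xK≈0 : x * y ^ k ≈ 0#
        xK≈0 = trans (*-congˡ K≈0) (zeroʳ x)
        inverse≈1 : odd-inverse k ≈ 1#
        inverse≈1 = begin
          odd-inverse k                   ≈⟨ *-identityˡ _ ⟨
          1# * odd-inverse k              ≈⟨ *-congʳ (minus-zero xK≈0) ⟨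
          odd-factor k * odd-inverse k    ≈⟨ inv-inverse _ ⟩
          1#                              ∎

    lambert-sum : sum lambert-term (suc M) * O (suc M) ^ 4 ≈ E (suc M) ^ 4
    lambert-sum = trans (*-congʳ (trans (sum-cong (λ n → sym (u-0 n)) (suc M)) (sym (u-sum (suc M))))) u-∞

  -- Geometric series in odd powers.

  odd-power : Carrier → ℕ → Carrier
  odd-power z i = z * (z * z) ^ i

  ^-even : ∀ z i → z ^ (2 ℕ.* i) ≈ (z * z) ^ i
  ^-even z i = trans (sym (^-assocʳ z 2 i)) (^-congˡ i (*-congˡ (*-identityʳ z)))

  odd-power-comm : ∀ z i j → odd-power (odd-power z i) j ≈ odd-power (odd-power z j) i
  odd-power-comm z i j = begin
    odd-power (odd-power z i) j             ≈⟨ unfold i j ⟩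
    z ^ (suc (2 ℕ.* i) ℕ.* suc (2 ℕ.* j))   ≡⟨ ≡.cong (z ^_) (ℕ.*-comm (suc (2 ℕ.* i)) (suc (2 ℕ.* j))) ⟩
    z ^ (suc (2 ℕ.* j) ℕ.* suc (2 ℕ.* i))   ≈⟨ unfold j i ⟨
    odd-power (odd-power z j) i             ∎
    where
    odd-power≈ : ∀ z i → odd-power z i ≈ z ^ suc (2 ℕ.* i)
    odd-power≈ z i = *-congˡ (sym (^-even z i))
    unfold : ∀ i j → odd-power (odd-power z i) j ≈ z ^ (suc (2 ℕ.* i) ℕ.* suc (2 ℕ.* j))
    unfold i j = trans (odd-power≈ _ j) (trans (^-congˡ (suc (2 ℕ.* j)) (odd-power≈ z i)) (^-assocʳ z (suc (2 ℕ.* i)) (suc (2 ℕ.* j))))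

  odd : ℕ → Carrier
  odd zero    = 1#
  odd (suc n) = odd n + (1# + 1#)

  geometric-odd : ∀ z n → (1# - z * z) * sum (odd-power z) n ≈ z - odd-power z n
  geometric-odd z zero    = trans (zeroʳ _) (sym (trans (+-congˡ (-‿cong (*-identityʳ z))) (-‿inverseʳ z)))
  geometric-odd z (suc n) = begin
    (1# - z * z) * (odd-power z n + sum (odd-power z) n)                  ≈⟨ distribˡ _ _ _ ⟩
    (1# - z * z) * odd-power z n + (1# - z * z) * sum (odd-power z) n     ≈⟨ +-congˡ (geometric-odd z n) ⟩
    (1# - z * z) * odd-power z n + (z - odd-power z n)
      ≈⟨ solve 2 (λ z w → (z :^ 0 :- z :* z) :* (z :* w) :+ (z :- z :* w) := z :- z :* ((z :* z) :* w)) refl z ((z * z) ^ n) ⟩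
    z - odd-power z (suc n) ∎

  -- The subtracted remainder is (1 - z²)² times the tail Σ_{i ≥ n} (2i + 1) z^{2i+1}.
  weighted-geometric-odd : ∀ z n → (1# - z * z) ^ 2 * sum (λ i → odd i * odd-power z i) n
    ≈ z * (1# + z * z) - odd-power z n * (odd n * (1# - z * z) + (z * z + z * z))
  weighted-geometric-odd z zero    = trans (zeroʳ _) (sym (trans (+-congˡ (-‿cong
    (solve 1 (λ z → (z :* z :^ 0) :* (z :^ 0 :* (z :^ 0 :- z :* z) :+ (z :* z :+ z :* z)) := z :* (z :^ 0 :+ z :* z)) refl z)))
    (-‿inverseʳ _)))
  weighted-geometric-odd z (suc n) = begin
    (1# - z * z) ^ 2 * (odd n * odd-power z n + Σ)
      ≈⟨ distribˡ _ _ _ ⟩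
    (1# - z * z) ^ 2 * (odd n * odd-power z n) + (1# - z * z) ^ 2 * Σ
      ≈⟨ +-congˡ (weighted-geometric-odd z n) ⟩
    (1# - z * z) ^ 2 * (odd n * odd-power z n) + (z * (1# + z * z) - odd-power z n * (odd n * (1# - z * z) + (z * z + z * z)))
      ≈⟨ solve 3 (λ z o w → let one = z :^ 0; r = one :- z :* z; s = z :* z :+ z :* z in
           r :^ 2 :* (o :* (z :* w)) :+ (z :* (one :+ z :* z) :- (z :* w) :* (o :* r :+ s))
         := z :* (one :+ z :* z) :- (z :* ((z :* z) :* w)) :* ((o :+ (one :+ one)) :* r :+ s))
         refl z (odd n) ((z * z) ^ n) ⟩
    z * (1# + z * z) - odd-power z (suc n) * (odd (suc n) * (1# - z * z) + (z * z + z * z)) ∎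
    where Σ = sum (λ i → odd i * odd-power z i) n

  euler-parity : ∀ z n → prod (λ i → 1# - z ^ suc i) (2 ℕ.* n)
    ≈ prod (λ i → 1# - odd-power z i) n * prod (λ i → 1# - (z * z) ^ suc i) n
  euler-parity z n = trans (prod-parity _ n) (*-cong
    (prod-cong (λ i → +-congˡ (-‿cong (*-congˡ (^-even z i)))) n)
    (prod-cong (λ i → +-congˡ (-‿cong (trans (sym (*-assoc z z _)) (*-congˡ (^-even z i))))) n))

  -- The Wronskian of the Euler products at q and -q.

  module Wronskian
    (q : Carrier) (M : ℕ) (q^M≈0 : q ^ M ≈ 0#)
    (D : Carrier → Carrier)
    (D-cong : ∀ {a b} → a ≈ b → D a ≈ D b)
    (D-+ : ∀ a b → D (a + b) ≈ D a + D b)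
    (D-neg : ∀ a → D (- a) ≈ - D a)
    (D-* : ∀ a b → D (a * b) ≈ D a * b + a * D b)
    (D-1 : D 1# ≈ 0#)
    (D-q : D q ≈ q)
    where

    wronskian : Carrier → Carrier → Carrier
    wronskian a b = a * D b - D a * b

    wronskian-cong : ∀ {a b a′ b′} → a ≈ a′ → b ≈ b′ → wronskian a b ≈ wronskian a′ b′
    wronskian-cong a b = +-cong (*-cong a (D-cong b)) (-‿cong (*-cong (D-cong a) b))

    -- `wronskian a b` is ab times the difference of the logarithmic derivatives of b and a.
    -- Logarithmic derivatives add up over products; this is that additivity with the denominators
    -- cleared.
    wronskian-* : ∀ a b c d → wronskian (a * b) (c * d) ≈ (a * c) * wronskian b d + (b * d) * wronskian a c
    wronskian-* a b c d = trans (+-cong (*-congˡ (D-* c d)) (-‿cong (*-congʳ (D-* a b))))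
      (solve 8 (λ a a′ b b′ c c′ d d′ → (a :* b) :* (c′ :* d :+ c :* d′) :- (a′ :* b :+ a :* b′) :* (c :* d)
        := (a :* c) :* (b :* d′ :- b′ :* d) :+ (b :* d) :* (a :* c′ :- a′ :* c)) refl a (D a) b (D b) c (D c) d (D d))

    wronskian-self : ∀ b → wronskian b b ≈ 0#
    wronskian-self b = trans (+-congˡ (-‿cong (*-comm _ _))) (-‿inverseʳ _)

    private
      module T = Nilpotent (q * q) M (Nilpotent.multiple-nilpotent q M q^M≈0 q)
      N = suc M

      Q : ℕ → Carrier
      Q = odd-power q

    open T using (O; E; odd-factor; even-factor; odd-inverse)

    D-Q : ∀ j → D (Q j) ≈ odd j * Q j
    D-Q zero    = begin
      D (q * 1#)   ≈⟨ D-cong (*-identityʳ q) ⟩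
      D q          ≈⟨ D-q ⟩
      q            ≈⟨ solve 1 (λ q → q := q :^ 0 :* (q :* q :^ 0)) refl q ⟩
      1# * Q 0     ∎
    D-Q (suc j) = begin
      D (q * ((q * q) * (q * q) ^ j))              ≈⟨ D-cong (solve 2 (λ q w → q :* ((q :* q) :* w) := (q :* q) :* (q :* w)) refl q _) ⟩
      D ((q * q) * Q j)                            ≈⟨ D-* _ _ ⟩
      D (q * q) * Q j + (q * q) * D (Q j)          ≈⟨ +-cong (*-congʳ (trans (D-* q q) (+-cong (*-congʳ D-q) (*-congˡ D-q)))) (*-congˡ (D-Q j)) ⟩
      (q * q + q * q) * Q j + (q * q) * (odd j * Q j)
        ≈⟨ solve 3 (λ q w o → (q :* q :+ q :* q) :* (q :* w) :+ (q :* q) :* (o :* (q :* w)) := (o :+ (q :^ 0 :+ q :^ 0)) :* (q :* ((q :* q) :* w))) refl q _ (odd j) ⟩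
      odd (suc j) * Q (suc j)                      ∎

    Q²-factor : ∀ j → 1# - Q j * Q j ≈ odd-factor j
    Q²-factor j = +-congˡ (-‿cong (trans
      (solve 2 (λ q w → (q :* w) :* (q :* w) := (q :* q) :* (w :* w)) refl q _)
      (*-congˡ (sym (^-distrib-* (q * q) (q * q) j)))))

    minus-Q plus-Q : ℕ → Carrier
    minus-Q = prod (λ j → 1# - Q j)
    plus-Q  = prod (λ j → 1# + Q j)

    minus*plus : ∀ n → minus-Q n * plus-Q n ≈ O n
    minus*plus n = trans (sym (prod-* _ _ n)) (prod-cong (λ j →
      trans (solve 1 (λ q → (q :^ 0 :- q) :* (q :^ 0 :+ q) := q :^ 0 :- q :* q) refl (Q j)) (Q²-factor j)) n)

    lambert : ℕ → Carrier
    lambert = sum (λ j → odd j * (Q j * odd-inverse j))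

    -- The pair 1 - qᵐ, 1 + qᵐ with m = 2j + 1 contributes 2m qᵐ / (1 - q^{2m}) to the difference of
    -- logarithmic derivatives, and `O n` is the product of all these pairs.
    wronskian-minus-plus : ∀ n → wronskian (minus-Q n) (plus-Q n) ≈ (1# + 1#) * (O n * lambert n)
    wronskian-minus-plus zero    = trans (wronskian-self 1#) (sym (trans (*-congˡ (zeroʳ _)) (zeroʳ _)))
    wronskian-minus-plus (suc n) = begin
      wronskian ((1# - Q n) * minus-Q n) ((1# + Q n) * plus-Q n)
        ≈⟨ wronskian-* _ _ _ _ ⟩
      ((1# - Q n) * (1# + Q n)) * wronskian (minus-Q n) (plus-Q n) + (minus-Q n * plus-Q n) * wronskian (1# - Q n) (1# + Q n)
        ≈⟨ +-cong (*-cong (solve 1 (λ q → (q :^ 0 :- q) :* (q :^ 0 :+ q) := q :^ 0 :- q :* q) refl (Q n)) (wronskian-minus-plus n))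
                  (*-cong (minus*plus n) factor) ⟩
      (1# - Q n * Q n) * ((1# + 1#) * (O n * lambert n)) + O n * ((1# + 1#) * (odd n * Q n))
        ≈⟨ +-cong (*-congʳ (Q²-factor n)) (trans (sym (*-identityʳ _)) (*-congˡ (sym (T.inv-inverse _)))) ⟩
      odd-factor n * ((1# + 1#) * (O n * lambert n)) + (O n * ((1# + 1#) * (odd n * Q n))) * (odd-factor n * odd-inverse n)
        ≈⟨ solve 6 (λ f o l ν q i → let two = f :^ 0 :+ f :^ 0 in
             f :* (two :* (o :* l)) :+ (o :* (two :* (ν :* q))) :* (f :* i) := two :* ((f :* o) :* (ν :* (q :* i) :+ l)))
             refl (odd-factor n) (O n) (lambert n) (odd n) (Q n) (odd-inverse n) ⟩
      (1# + 1#) * (O (suc n) * lambert (suc n)) ∎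
      where
      factor : wronskian (1# - Q n) (1# + Q n) ≈ (1# + 1#) * (odd n * Q n)
      factor = begin
        (1# - Q n) * D (1# + Q n) - D (1# - Q n) * (1# + Q n)
          ≈⟨ +-cong (*-congˡ (trans (D-+ _ _) (+-cong D-1 (D-Q n))))
               (-‿cong (*-congʳ (trans (D-+ _ _) (+-cong D-1 (trans (D-neg _) (-‿cong (D-Q n))))))) ⟩
        (1# - Q n) * (0# + odd n * Q n) - (0# - odd n * Q n) * (1# + Q n)
          ≈⟨ +-cong (*-congˡ (+-identityˡ _)) (-‿cong (*-congʳ (+-identityˡ _))) ⟩
        (1# - Q n) * (odd n * Q n) - (- (odd n * Q n)) * (1# + Q n)
          ≈⟨ solve 2 (λ q w → (q :^ 0 :- q) :* w :- (:- w) :* (q :^ 0 :+ q) := (q :^ 0 :+ q :^ 0) :* w) refl (Q n) (odd n * Q n) ⟩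
        (1# + 1#) * (odd n * Q n) ∎

    odd-power-vanishes : ∀ w → odd-power (q * w) N ≈ 0#
    odd-power-vanishes w = trans (*-congˡ (trans (*-congˡ (trans (^-distrib-* _ _ M)
      (0*≈0 _ (Nilpotent.multiple-nilpotent q M q^M≈0 w)))) (zeroʳ _))) (zeroʳ _)

    cancel-odd-factor : ∀ j {a b} → (1# - Q j * Q j) * a ≈ b → b * odd-inverse j ≈ a
    cancel-odd-factor j {a} {b} eq = begin
      b * odd-inverse j                          ≈⟨ *-congʳ eq ⟨
      ((1# - Q j * Q j) * a) * odd-inverse j     ≈⟨ *-congʳ (*-congʳ (Q²-factor j)) ⟩
      (odd-factor j * a) * odd-inverse j         ≈⟨ solve 3 (λ a b c → (a :* b) :* c := b :* (a :* c)) refl _ _ _ ⟩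
      a * (odd-factor j * odd-inverse j)         ≈⟨ *-congˡ (T.inv-inverse _) ⟩
      a * 1#                                     ≈⟨ *-identityʳ a ⟩
      a                                          ∎

    -- Both sides are Σ odd j · q^{odd i · odd j}.
    lambert-swap : lambert N ≈ q * sum T.lambert-term N
    lambert-swap = begin
      sum (λ j → odd j * (Q j * odd-inverse j)) N
        ≈⟨ sum-cong (λ j → trans (*-congˡ (cancel-odd-factor j (trans (geometric-odd (Q j) N) (minus-zero (odd-power-vanishes _)))))
             (*-distribˡ-sum (odd j) (odd-power (Q j)) N)) N ⟩
      sum (λ j → sum (λ i → odd j * odd-power (Q j) i) N) N
        ≈⟨ sum-swap (λ j i → odd j * odd-power (Q j) i) N N ⟩
      sum (λ i → sum (λ j → odd j * odd-power (Q j) i) N) N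
        ≈⟨ sum-cong (λ i → trans (sum-cong (λ j → *-congˡ (odd-power-comm q j i)) N) (inner i)) N ⟩
      sum (λ i → q * T.lambert-term i) N
        ≈⟨ *-distribˡ-sum q T.lambert-term N ⟨
      q * sum T.lambert-term N ∎
      where
      inner : ∀ i → sum (λ j → odd j * odd-power (Q i) j) N ≈ q * T.lambert-term i
      inner i = begin
        sum (λ j → odd j * odd-power (Q i) j) N
          ≈⟨ cancel-odd-factor i refl ⟨
        ((1# - Q i * Q i) * sum (λ j → odd j * odd-power (Q i) j) N) * odd-inverse i
          ≈⟨ *-congʳ (cancel-odd-factor i (trans (solve 2 (λ r s → r :* (r :* s) := r :^ 2 :* s) refl _ _)
               (trans (weighted-geometric-odd (Q i) N) (minus-zero (0*≈0 _ (odd-power-vanishes _)))))) ⟨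
        ((Q i * (1# + Q i * Q i)) * odd-inverse i) * odd-inverse i
          ≈⟨ *-congʳ (*-congʳ (*-congˡ (+-congˡ (trans
               (solve 2 (λ q w → (q :* w) :* (q :* w) := (q :* q) :* (w :* w)) refl q _)
               (*-congˡ (sym (^-distrib-* (q * q) (q * q) i))))))) ⟩
        ((Q i * (1# + (q * q) * ((q * q) * (q * q)) ^ i)) * odd-inverse i) * odd-inverse i
          ≈⟨ solve 4 (λ q w s v → ((q :* w :* s) :* v) :* v := q :* (w :* s :* v :^ 2)) refl q _ _ (odd-inverse i) ⟩
        q * T.lambert-term i ∎

    euler₂ : Carrier
    euler₂ = T.euler N

    euler₂≈O*E : euler₂ ≈ O N * E N
    euler₂≈O*E = begin
      T.euler N            ≈⟨ prod-stable _ (λ i N≤i → minus-zero (T.power-vanishes (ℕ.≤-trans (ℕ.n≤1+n M) (ℕ.m≤n⇒m≤1+n N≤i)))) (ℕ.m≤m+n N (N ℕ.+ 0)) ⟨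
      T.euler (2 ℕ.* N)    ≈⟨ euler-parity (q * q) N ⟩
      O N * prod (λ i → 1# - ((q * q) * (q * q)) ^ suc i) N
        ≈⟨ *-congˡ (prod-cong (λ i → +-congˡ (-‿cong (*-assoc (q * q) (q * q) _))) N) ⟩
      O N * E N            ∎

    euler[q] euler[-q] : Carrier
    euler[q]  = prod (λ i → 1# - q ^ suc i) (2 ℕ.* N)
    euler[-q] = prod (λ i → 1# - (- q) ^ suc i) (2 ℕ.* N)

    -- F(q) and F(-q) share the even factor `euler₂`, whose Wronskian with itself is zero; what
    -- remains is `euler₂`² times the Wronskian of `minus-Q` and `plus-Q`. As `euler₂` is OE and the
    -- Lambert series is q E⁴ / O⁴, all powers of O cancel.
    wronskian-euler : wronskian euler[q] euler[-q] * euler₂ ≈ (1# + 1#) * (q * E N ^ 7)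
    wronskian-euler = begin
      wronskian euler[q] euler[-q] * B
        ≈⟨ *-congʳ (wronskian-cong (euler-parity q N) euler[-q]≈) ⟩
      wronskian (minus-Q N * B) (plus-Q N * B) * B
        ≈⟨ *-congʳ (wronskian-* _ _ _ _) ⟩
      ((minus-Q N * plus-Q N) * wronskian B B + (B * B) * wronskian (minus-Q N) (plus-Q N)) * B
        ≈⟨ *-congʳ (+-cong (trans (*-congˡ (wronskian-self B)) (zeroʳ _)) (*-congˡ (wronskian-minus-plus N))) ⟩
      (0# + (B * B) * ((1# + 1#) * (O N * lambert N))) * B
        ≈⟨ *-congʳ (+-identityˡ _) ⟩
      ((B * B) * ((1# + 1#) * (O N * lambert N))) * B
        ≈⟨ *-cong (*-cong (*-cong euler₂≈O*E euler₂≈O*E) (*-congˡ (*-congˡ lambert-swap))) euler₂≈O*E ⟩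
      (((O N * E N) * (O N * E N)) * ((1# + 1#) * (O N * (q * Λ)))) * (O N * E N)
        ≈⟨ solve 4 (λ o e q l → let two = q :^ 0 :+ q :^ 0 in
             (((o :* e) :* (o :* e)) :* (two :* (o :* (q :* l)))) :* (o :* e) := two :* (q :* ((l :* o :^ 4) :* e :^ 3))) refl (O N) (E N) q Λ ⟩
      (1# + 1#) * (q * ((Λ * O N ^ 4) * E N ^ 3))
        ≈⟨ *-congˡ (*-congˡ (*-congʳ T.lambert-sum)) ⟩
      (1# + 1#) * (q * (E N ^ 4 * E N ^ 3))
        ≈⟨ *-congˡ (*-congˡ (sym (^-homo-* (E N) 4 3))) ⟩
      (1# + 1#) * (q * E N ^ 7) ∎
      where
      B = euler₂
      Λ = sum T.lambert-term N
      -q²≈ : - q * - q ≈ q * q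
      -q²≈ = solve 1 (λ q → (:- q) :* (:- q) := q :* q) refl q
      euler[-q]≈ : euler[-q] ≈ plus-Q N * B
      euler[-q]≈ = trans (euler-parity (- q) N) (*-cong
        (prod-cong (λ i → trans (+-congˡ (-‿cong (*-congˡ (^-congˡ i -q²≈))))
          (solve 2 (λ q w → q :^ 0 :- (:- q) :* w := q :^ 0 :+ q :* w) refl q _)) N)
        (prod-cong (λ i → +-congˡ (-‿cong (^-congˡ (suc i) -q²≈))) N))

    -- Meant for A = 1 / (f₂ f₄^e), the generating function in q² with e = c - 1. The exponent 7 + e
    -- will be p, and modulo p the p-th power of `E N` is a series in q^p.
    wronskian-quotient : ∀ e {A} → A * (euler₂ * E N ^ e) ≈ 1# →
      wronskian euler[q] euler[-q] ≈ ((1# + 1#) * (q * A)) * E N ^ (7 ℕ.+ e)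
    wronskian-quotient e {A} eq = begin
      W                                             ≈⟨ *-identityʳ W ⟨
      W * 1#                                        ≈⟨ *-congˡ eq ⟨
      W * (A * (euler₂ * E N ^ e))                  ≈⟨ solve 4 (λ w a b c → w :* (a :* (b :* c)) := (w :* b) :* (a :* c)) refl _ _ _ _ ⟩
      (W * euler₂) * (A * E N ^ e)                  ≈⟨ *-congʳ wronskian-euler ⟩
      ((1# + 1#) * (q * E N ^ 7)) * (A * E N ^ e)
        ≈⟨ solve 5 (λ t q c a d → (t :* (q :* c)) :* (a :* d) := (t :* (q :* a)) :* (c :* d)) refl (1# + 1#) q (E N ^ 7) A (E N ^ e) ⟩
      ((1# + 1#) * (q * A)) * (E N ^ 7 * E N ^ e)   ≈⟨ *-congˡ (^-homo-* (E N) 7 e) ⟨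
      ((1# + 1#) * (q * A)) * E N ^ (7 ℕ.+ e)       ∎
      where W = wronskian euler[q] euler[-q]

  -- Frobenius and sums of two squares in characteristic p.

  module Characteristic (p : ℕ) (p-prime : Prime p) (p×1≈0 : p × 1# ≈ 0#) where

    ×-multiple : ∀ {n} → p ℕ.∣ n → ∀ y → n × y ≈ 0#
    ×-multiple (ℕ.divides k ≡.refl) y = begin
      (k ℕ.* p) × y       ≈⟨ ×-assocˡ y k p ⟨
      k × (p × y)         ≈⟨ ×-congʳ k (×-congʳ p (*-identityˡ y)) ⟨
      k × (p × (1# * y))  ≈⟨ ×-congʳ k (×-assoc-* p 1# y) ⟨
      k × ((p × 1#) * y)  ≈⟨ ×-congʳ k (0*≈0 y p×1≈0) ⟩
      k × 0#              ≈⟨ ×-zero k ⟩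
      0#                  ∎
      where
      ×-zero : ∀ k → k × 0# ≈ 0#
      ×-zero zero    = refl
      ×-zero (suc k) = trans (+-identityˡ _) (×-zero k)

    frobenius-+ : ∀ a b → (a + b) ^ p ≈ a ^ p + b ^ p
    frobenius-+ a b = expand p ≡.refl
      where
      expand : ∀ n → n ≡ p → (a + b) ^ n ≈ a ^ n + b ^ n
      expand zero    0≡p = contradiction (≡.subst Prime (≡.sym 0≡p) p-prime) ¬prime[0]
      expand (suc m) m+1≡p = begin
        (a + b) ^ suc m
          ≈⟨ Binomial.theorem (suc m) a b ⟩
        t zero + Σ.sum (λ k → t (suc k))
          ≈⟨ +-congˡ (Σ.sum-init-last (λ k → t (suc k))) ⟩
        t zero + (Σ.sum (λ k → t (suc (inject₁ k))) + t (suc (fromℕ m)))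
          ≈⟨ +-cong first (+-cong (trans (Σ.sum-cong-≋ middle) (Σ.sum-replicate-zero m)) last) ⟩
        b ^ suc m + (0# + a ^ suc m)
          ≈⟨ trans (+-congˡ (+-identityˡ _)) (+-comm _ _) ⟩
        a ^ suc m + b ^ suc m ∎
        where
        t = Binomial.binomialTerm a b (suc m)
        first : t zero ≈ b ^ suc m
        first = trans (+-identityʳ _) (*-identityˡ _)
        middle : ∀ k → t (suc (inject₁ k)) ≈ 0#
        middle k = ×-multiple (≡.subst (ℕ._∣ suc m ℕ.C suc (toℕ (inject₁ k))) m+1≡p
          (prime∣binomial (≡.subst Prime (≡.sym m+1≡p) p-prime) (s≤s (≡.subst (_< m) (≡.sym (toℕ-inject₁ k)) (toℕ<n k))))) _
        last : t (suc (fromℕ m)) ≈ a ^ suc m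
        last = begin
          (suc m ℕ.C suc (toℕ (fromℕ m))) × (a ^ suc (toℕ (fromℕ m)) * b ^ (m ℕ.∸ toℕ (fromℕ m)))
            ≡⟨ ≡.cong (λ i → (suc m ℕ.C suc i) × (a ^ suc i * b ^ (m ℕ.∸ i))) (toℕ-fromℕ m) ⟩
          (suc m ℕ.C suc m) × (a ^ suc m * b ^ (m ℕ.∸ m))
            ≡⟨ ≡.cong₂ (λ i j → i × (a ^ suc m * b ^ j)) (nCn≡1 (suc m)) (ℕ.n∸n≡0 m) ⟩
          1 × (a ^ suc m * 1#)
            ≈⟨ trans (+-identityʳ _) (*-identityʳ _) ⟩
          a ^ suc m ∎

    -- Frobenius is additive and fixes `1#`, hence it fixes all multiples of `1#`.
    fermat : ∀ n → (n × 1#) ^ p ≈ n × 1#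
    fermat zero    = 0^n≈0 (prime⇒nonZero p-prime)
      where
      0^n≈0 : ∀ {n} → ℕ.NonZero n → 0# ^ n ≈ 0#
      0^n≈0 {suc n} _ = zeroˡ _
    fermat (suc n) = trans (frobenius-+ 1# (n × 1#)) (+-cong (1^n≈1 p) (fermat n))
      where
      1^n≈1 : ∀ n → 1# ^ n ≈ 1#
      1^n≈1 zero    = refl
      1^n≈1 (suc n) = trans (*-identityˡ _) (1^n≈1 n)

    module Odd (h : ℕ) (p≡ : p ≡ suc (2 ℕ.* h)) where

      ^p≈ : ∀ a → a ^ p ≈ odd-power a h
      ^p≈ a = trans (^-congʳ a p≡) (*-congˡ (^-even a h))

      neg-^p : ∀ a → (- a) ^ p ≈ - (a ^ p)
      neg-^p a = begin
        (- a) ^ p                  ≈⟨ ^p≈ (- a) ⟩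
        - a * (- a * - a) ^ h      ≈⟨ *-congˡ (^-congˡ h (solve 1 (λ a → (:- a) :* (:- a) := a :* a) refl a)) ⟩
        - a * (a * a) ^ h          ≈⟨ solve 2 (λ a b → (:- a) :* b := :- (a :* b)) refl _ _ ⟩
        - odd-power a h            ≈⟨ -‿cong (^p≈ a) ⟨
        - (a ^ p)                  ∎

      frobenius-prod : ∀ (z : ℕ → Carrier) n → prod (λ i → 1# - z i) n ^ p ≈ prod (λ i → 1# - z i ^ p) n
      frobenius-prod z zero    = fermat-1
        where
        fermat-1 : 1# ^ p ≈ 1#
        fermat-1 = trans (^-congˡ p (sym (+-identityʳ 1#))) (trans (fermat 1) (+-identityʳ 1#))
      frobenius-prod z (suc n) = trans (^-distrib-* _ _ p) (*-cong
        (trans (frobenius-+ 1# (- z n)) (+-cong (frobenius-prod z 0) (neg-^p (z n)))) (frobenius-prod z n))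

      -- If a² = -b² and (p - 1)/2 is odd, then ab = aᵖb = -abᵖ = -ab.
      sum-of-squares : ∀ m → h ≡ suc (2 ℕ.* m) → ∀ {a b} → a ^ p ≈ a → b ^ p ≈ b →
        a * a + b * b ≈ 0# → a * b + a * b ≈ 0#
      sum-of-squares m ≡.refl {a} {b} aᵖ bᵖ eq = begin
        a * b + a * b                                     ≈⟨ +-congʳ (*-congʳ (trans (sym aᵖ) (^p≈ a))) ⟩
        (a * (a * a) ^ h) * b + a * b                     ≈⟨ +-congʳ (*-congʳ (*-congˡ power)) ⟩
        (a * - ((b * b) ^ h)) * b + a * b                 ≈⟨ solve 3 (λ a b c → (a :* (:- c)) :* b :+ a :* b := :- (a :* (b :* c)) :+ a :* b) refl a b _ ⟩
        - (a * (b * (b * b) ^ h)) + a * b                 ≈⟨ +-congʳ (-‿cong (*-congˡ (trans (sym (^p≈ b)) bᵖ))) ⟩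
        - (a * b) + a * b                                 ≈⟨ -‿inverseˡ _ ⟩
        0#                                                ∎
        where
        a²≈ : a * a ≈ - (b * b)
        a²≈ = x-y≈0⇒x≈y (trans (solve 2 (λ x y → x :- (:- y) := x :+ y) refl _ _) eq)
        power : (a * a) ^ h ≈ - ((b * b) ^ h)
        power = begin
          (a * a) ^ h                                    ≈⟨ ^-congˡ h a²≈ ⟩
          (- (b * b)) ^ suc (2 ℕ.* m)                    ≈⟨ *-congˡ (^-even _ m) ⟩
          - (b * b) * (- (b * b) * - (b * b)) ^ m        ≈⟨ *-congˡ (^-congˡ m (solve 1 (λ a → (:- a) :* (:- a) := a :* a) refl _)) ⟩
          - (b * b) * ((b * b) * (b * b)) ^ m            ≈⟨ *-congˡ (^-even _ m) ⟨
          - (b * b) * (b * b) ^ (2 ℕ.* m)                ≈⟨ solve 2 (λ a b → (:- a) :* b := :- (a :* b)) refl _ _ ⟩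
          - ((b * b) ^ suc (2 ℕ.* m))                    ∎

      -- u and v are carried into the ring, where they become fixed points of Frobenius. The
      -- conclusion is kept as a multiple of `1#`, so that `×-faithful` can turn it back into a
      -- divisibility of integers.
      ∣-squares⇒2ab≈0 : ∀ m → h ≡ suc (2 ℕ.* m) → ∀ u v → p ℕ.∣ u ℕ.* u ℕ.+ v ℕ.* v → (2 ℕ.* (u ℕ.* v)) × 1# ≈ 0#
      ∣-squares⇒2ab≈0 m h≡ u v p∣ = begin
        (2 ℕ.* (u ℕ.* v)) × 1#                      ≈⟨ ×1-homo-* 2 (u ℕ.* v) ⟩
        (2 × 1#) * ((u ℕ.* v) × 1#)                 ≈⟨ *-congˡ (×1-homo-* u v) ⟩
        (1# + (1# + 0#)) * (a * b)                  ≈⟨ *-congʳ (+-congˡ (+-identityʳ 1#)) ⟩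
        (1# + 1#) * (a * b)                         ≈⟨ solve 1 (λ y → (y :^ 0 :+ y :^ 0) :* y := y :+ y) refl (a * b) ⟩
        a * b + a * b                               ≈⟨ sum-of-squares m h≡ (fermat u) (fermat v) squares ⟩
        0#                                          ∎
        where
        a = u × 1#
        b = v × 1#
        squares : a * a + b * b ≈ 0#
        squares = begin
          a * a + b * b                             ≈⟨ +-cong (×1-homo-* u u) (×1-homo-* v v) ⟨
          (u ℕ.* u) × 1# + (v ℕ.* v) × 1#           ≈⟨ ×-homo-+ 1# (u ℕ.* u) (v ℕ.* v) ⟨
          (u ℕ.* u ℕ.+ v ℕ.* v) × 1#                ≈⟨ ×-multiple p∣ 1# ⟩
          0#                                        ∎

open import Defs

-- The algebra of formal power series.

module SeriesAlgebra where

  open import Data.Integer.Base using (-_; _+_; _*_)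
  open ≡.≡-Reasoning

  infixl 6 _⊕_
  infixr 7 _·_

  _⊕_ : Series → Series → Series
  (A ⊕ B) n = A n + B n

  ⊝_ : Series → Series
  (⊝ A) n = - A n

  𝟘 : Series
  𝟘 _ = 0ℤ

  _·_ : ℤ → Series → Series
  (c · A) n = c * A n

  const : ℤ → Series
  const c zero    = c
  const c (suc _) = 0ℤ

  -- `(A ⊛ B) (suc n)` computes to `A 0 * B (suc n) + (tail A ⊛ B) n`, so inductions on the
  -- coefficient index pass from A to `tail A`.
  tail : Series → Series
  tail A n = A (suc n)

  ⊛-congʳ : ∀ B {A A′} → (∀ n → A n ≡ A′ n) → ∀ n → (A ⊛ B) n ≡ (A′ ⊛ B) n
  ⊛-congʳ B A≡ zero    = ≡.cong (λ a → a * B 0 + 0ℤ) (A≡ 0)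
  ⊛-congʳ B A≡ (suc n) = ≡.cong₂ _+_ (≡.cong (_* B (suc n)) (A≡ 0)) (⊛-congʳ B (λ m → A≡ (suc m)) n)

  ⊛-zeroˡ : ∀ A n → (𝟘 ⊛ A) n ≡ 0ℤ
  ⊛-zeroˡ A zero    = ≡.refl
  ⊛-zeroˡ A (suc n) = ≡.trans (ℤ.+-identityˡ _) (⊛-zeroˡ A n)

  const-⊛ : ∀ c A n → (const c ⊛ A) n ≡ c * A n
  const-⊛ c A zero    = ℤ.+-identityʳ _
  const-⊛ c A (suc n) = ≡.trans (≡.cong (_+_ (c * A (suc n))) (⊛-zeroˡ A n)) (ℤ.+-identityʳ _)

  const-1 : ∀ n → const 1ℤ n ≡ 𝟙 n
  const-1 zero    = ≡.refl
  const-1 (suc n) = ≡.refl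

  const-+ : ∀ c d n → const (c + d) n ≡ (const c ⊕ const d) n
  const-+ c d zero    = ≡.refl
  const-+ c d (suc n) = ≡.refl

  const-neg : ∀ c n → const (- c) n ≡ (⊝ const c) n
  const-neg c zero    = ≡.refl
  const-neg c (suc n) = ≡.refl

  const-* : ∀ c d n → const (c * d) n ≡ (const c ⊛ const d) n
  const-* c d zero    = ≡.sym (const-⊛ c (const d) zero)
  const-* c d (suc n) = ≡.sym (≡.trans (const-⊛ c (const d) (suc n)) (ℤ.*-zeroʳ c))

  ⊛-identityˡ : ∀ A n → (𝟙 ⊛ A) n ≡ A n
  ⊛-identityˡ A n = ≡.trans (⊛-congʳ A (λ m → ≡.sym (const-1 m)) n)
    (≡.trans (const-⊛ 1ℤ A n) (ℤ.*-identityˡ _))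

  ⊛-distribʳ-⊕ : ∀ A B C n → ((B ⊕ C) ⊛ A) n ≡ (B ⊛ A ⊕ C ⊛ A) n
  ⊛-distribʳ-⊕ A B C zero    = ring (A 0) (B 0) (C 0)
    where
    ring : ∀ a b c → (b + c) * a + 0ℤ ≡ (b * a + 0ℤ) + (c * a + 0ℤ)
    ring = ℤSolver.solve-∀
  ⊛-distribʳ-⊕ A B C (suc n) = ≡.trans (≡.cong (_+_ ((B 0 + C 0) * A (suc n))) (⊛-distribʳ-⊕ A (tail B) (tail C) n))
    (ring (A (suc n)) (B 0) (C 0) _ _)
    where
    ring : ∀ a b c s t → (b + c) * a + (s + t) ≡ (b * a + s) + (c * a + t)
    ring = ℤSolver.solve-∀

  ·-⊛ : ∀ c A B n → ((c · A) ⊛ B) n ≡ c * (A ⊛ B) n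
  ·-⊛ c A B zero    = ring c (A 0) (B 0)
    where
    ring : ∀ c a b → (c * a) * b + 0ℤ ≡ c * (a * b + 0ℤ)
    ring = ℤSolver.solve-∀
  ·-⊛ c A B (suc n) = ≡.trans (≡.cong (_+_ ((c * A 0) * B (suc n))) (·-⊛ c (tail A) B n)) (ring c (A 0) (B (suc n)) _)
    where
    ring : ∀ c a b s → (c * a) * b + c * s ≡ c * (a * b + s)
    ring = ℤSolver.solve-∀

  ⊛-assoc : ∀ A B C n → ((A ⊛ B) ⊛ C) n ≡ (A ⊛ (B ⊛ C)) n
  ⊛-assoc A B C zero    = ring (A 0) (B 0) (C 0)
    where
    ring : ∀ a b c → (a * b + 0ℤ) * c + 0ℤ ≡ a * (b * c + 0ℤ) + 0ℤ
    ring = ℤSolver.solve-∀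
  ⊛-assoc A B C (suc n) = begin
    (A 0 * B 0 + 0ℤ) * C (suc n) + ((A 0 · tail B ⊕ tail A ⊛ B) ⊛ C) n
      ≡⟨ ≡.cong (λ t → (A 0 * B 0 + 0ℤ) * C (suc n) + t)
           (≡.trans (⊛-distribʳ-⊕ C (A 0 · tail B) (tail A ⊛ B) n) (≡.cong₂ _+_ (·-⊛ (A 0) (tail B) C n) (⊛-assoc (tail A) B C n))) ⟩
    (A 0 * B 0 + 0ℤ) * C (suc n) + (A 0 * (tail B ⊛ C) n + (tail A ⊛ (B ⊛ C)) n)
      ≡⟨ ring (A 0) (B 0) (C (suc n)) _ _ ⟩
    A 0 * (B 0 * C (suc n) + (tail B ⊛ C) n) + (tail A ⊛ (B ⊛ C)) n ∎
    where
    ring : ∀ a b c s t → (a * b + 0ℤ) * c + (a * s + t) ≡ a * (b * c + s) + t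
    ring = ℤSolver.solve-∀

  -- The mirror image of the recursion by which `⊛` computes, peeling off the right factor;
  -- commutativity follows by matching the two.
  ⊛-sucʳ : ∀ A B n → (A ⊛ B) (suc n) ≡ (A ⊛ tail B) n + A (suc n) * B 0
  ⊛-sucʳ A B zero    = ring (A 0 * B 1) (A 1 * B 0)
    where
    ring : ∀ s t → s + (t + 0ℤ) ≡ (s + 0ℤ) + t
    ring = ℤSolver.solve-∀
  ⊛-sucʳ A B (suc n) = ≡.trans (≡.cong (_+_ (A 0 * B (suc (suc n)))) (⊛-sucʳ (tail A) B n)) (≡.sym (ℤ.+-assoc (A 0 * B (suc (suc n))) _ _))

  ⊛-comm : ∀ A B n → (A ⊛ B) n ≡ (B ⊛ A) n
  ⊛-comm A B zero    = ≡.cong (_+ 0ℤ) (ℤ.*-comm (A 0) (B 0))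
  ⊛-comm A B (suc n) = begin
    A 0 * B (suc n) + (tail A ⊛ B) n    ≡⟨ ≡.cong₂ _+_ (ℤ.*-comm (A 0) (B (suc n))) (⊛-comm (tail A) B n) ⟩
    B (suc n) * A 0 + (B ⊛ tail A) n    ≡⟨ ℤ.+-comm (B (suc n) * A 0) _ ⟩
    (B ⊛ tail A) n + B (suc n) * A 0    ≡⟨ ⊛-sucʳ B A n ⟨
    (B ⊛ A) (suc n)                     ∎

  θ : Series → Series
  θ A n = + n * A n

  θ-⊛ : ∀ A B n → θ (A ⊛ B) n ≡ (θ A ⊛ B ⊕ A ⊛ θ B) n
  θ-⊛ A B zero    = ring (A 0) (B 0)
    where
    ring : ∀ a b → 0ℤ * (a * b + 0ℤ) ≡ ((0ℤ * a) * b + 0ℤ) + (a * (0ℤ * b) + 0ℤ)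
    ring = ℤSolver.solve-∀
  θ-⊛ A B (suc n) = begin
    + suc n * (A 0 * B (suc n) + (tail A ⊛ B) n)
      ≡⟨ ring₁ (+ n) (A 0) (B (suc n)) _ ⟩
    (0ℤ * A 0) * B (suc n) + (+ n * (tail A ⊛ B) n + (tail A ⊛ B) n) + A 0 * (+ suc n * B (suc n))
      ≡⟨ ≡.cong (λ t → (0ℤ * A 0) * B (suc n) + (t + (tail A ⊛ B) n) + A 0 * (+ suc n * B (suc n))) (θ-⊛ (tail A) B n) ⟩
    (0ℤ * A 0) * B (suc n) + (((θ (tail A) ⊛ B) n + (tail A ⊛ θ B) n) + (tail A ⊛ B) n) + A 0 * (+ suc n * B (suc n))
      ≡⟨ ring₂ ((0ℤ * A 0) * B (suc n)) ((θ (tail A) ⊛ B) n) ((tail A ⊛ θ B) n) ((tail A ⊛ B) n) (A 0 * (+ suc n * B (suc n))) ⟩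
    ((0ℤ * A 0) * B (suc n) + ((θ (tail A) ⊛ B) n + (tail A ⊛ B) n)) + (A 0 * (+ suc n * B (suc n)) + (tail A ⊛ θ B) n)
      -- `θ (tail A) ⊕ tail A` is `tail (θ A)`: the shift of the index supplies the extra summand.
      ≡⟨ ≡.cong (λ t → ((0ℤ * A 0) * B (suc n) + t) + (A 0 * (+ suc n * B (suc n)) + (tail A ⊛ θ B) n))
           (≡.trans (≡.sym (⊛-distribʳ-⊕ B (θ (tail A)) (tail A) n)) (⊛-congʳ B (λ m → ring₃ (+ m) (A (suc m))) n)) ⟩
    (θ A ⊛ B) (suc n) + (A ⊛ θ B) (suc n) ∎
    where
    ring₁ : ∀ k a b s → (1ℤ + k) * (a * b + s) ≡ (0ℤ * a) * b + (k * s + s) + a * ((1ℤ + k) * b)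
    ring₁ = ℤSolver.solve-∀
    ring₂ : ∀ u s t v w → u + ((s + t) + v) + w ≡ (u + (s + v)) + (w + t)
    ring₂ = ℤSolver.solve-∀
    ring₃ : ∀ k a → k * a + a ≡ (1ℤ + k) * a
    ring₃ = ℤSolver.solve-∀

  q^-≢ : ∀ {m n} → m ≢ n → (q^ m) n ≡ 0ℤ
  q^-≢ {zero}  {zero}  m≢n = contradiction ≡.refl m≢n
  q^-≢ {zero}  {suc n} m≢n = ≡.refl
  q^-≢ {suc m} {zero}  m≢n = ≡.refl
  q^-≢ {suc m} {suc n} m≢n = q^-≢ (λ m≡n → m≢n (≡.cong suc m≡n))

  q^-⊛-< : ∀ {m n} A → n < m → (q^ m ⊛ A) n ≡ 0ℤ
  q^-⊛-< {suc m} {zero}  A n<m       = ≡.refl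
  q^-⊛-< {suc m} {suc n} A (s≤s n<m) = ≡.trans (ℤ.+-identityˡ _) (q^-⊛-< A n<m)

  q^-⊛-+ : ∀ m A n → (q^ m ⊛ A) (m ℕ.+ n) ≡ A n
  q^-⊛-+ zero    A n = ⊛-identityˡ A n
  q^-⊛-+ (suc m) A n = ≡.trans (ℤ.+-identityˡ _) (q^-⊛-+ m A n)

  q-⊛-suc : ∀ A n → (q^ 1 ⊛ A) (suc n) ≡ A n
  q-⊛-suc = q^-⊛-+ 1

  -- A(q) ↦ A(q²)
  dilate : Series → Series
  dilate A zero          = A 0
  dilate A (suc zero)    = 0ℤ
  dilate A (suc (suc n)) = dilate (tail A) n

  dilate-even : ∀ A n → dilate A (2 ℕ.* n) ≡ A n
  dilate-even A zero    = ≡.refl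
  dilate-even A (suc n) rewrite ℕ.+-suc n (n ℕ.+ 0) = dilate-even (tail A) n

  dilate-cong : ∀ {A B} n → (∀ {m} → m ≤ n → A m ≡ B m) → dilate A n ≡ dilate B n
  dilate-cong zero          A≡B = A≡B z≤n
  dilate-cong (suc zero)    A≡B = ≡.refl
  dilate-cong (suc (suc n)) A≡B = dilate-cong n (λ m≤n → A≡B (s≤s (ℕ.m≤n⇒m≤1+n m≤n)))

  dilate-⊕ : ∀ A B n → dilate (A ⊕ B) n ≡ (dilate A ⊕ dilate B) n
  dilate-⊕ A B zero          = ≡.refl
  dilate-⊕ A B (suc zero)    = ≡.refl
  dilate-⊕ A B (suc (suc n)) = dilate-⊕ (tail A) (tail B) n

  dilate-⊖ : ∀ A B n → dilate (A ⊖ B) n ≡ (dilate A ⊖ dilate B) n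
  dilate-⊖ A B zero          = ≡.refl
  dilate-⊖ A B (suc zero)    = ≡.refl
  dilate-⊖ A B (suc (suc n)) = dilate-⊖ (tail A) (tail B) n

  dilate-· : ∀ c A n → dilate (c · A) n ≡ (c · dilate A) n
  dilate-· c A zero          = ≡.refl
  dilate-· c A (suc zero)    = ≡.sym (ℤ.*-zeroʳ c)
  dilate-· c A (suc (suc n)) = dilate-· c (tail A) n

  dilate-⊛ : ∀ A B n → dilate (A ⊛ B) n ≡ (dilate A ⊛ dilate B) n
  dilate-⊛ A B zero          = ≡.refl
  dilate-⊛ A B (suc zero)    = ≡.sym (≡.trans (ℤ.+-identityʳ _) (ℤ.*-zeroʳ (A 0)))
  dilate-⊛ A B (suc (suc n)) = begin
    dilate (A 0 · tail B ⊕ tail A ⊛ B) n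
      ≡⟨ dilate-⊕ (A 0 · tail B) (tail A ⊛ B) n ⟩
    dilate (A 0 · tail B) n + dilate (tail A ⊛ B) n
      ≡⟨ ≡.cong₂ _+_ (dilate-· (A 0) (tail B) n) (≡.trans (dilate-⊛ (tail A) B n) (≡.sym (ℤ.+-identityˡ _))) ⟩
    A 0 * dilate (tail B) n + (0ℤ + (dilate (tail A) ⊛ dilate B) n) ∎

  dilate-𝟘 : ∀ n → dilate 𝟘 n ≡ 0ℤ
  dilate-𝟘 zero          = ≡.refl
  dilate-𝟘 (suc zero)    = ≡.refl
  dilate-𝟘 (suc (suc n)) = dilate-𝟘 n

  dilate-q^ : ∀ m n → dilate (q^ m) n ≡ (q^ (2 ℕ.* m)) n
  dilate-q^ zero    zero          = ≡.refl
  dilate-q^ zero    (suc zero)    = ≡.refl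
  dilate-q^ zero    (suc (suc n)) = dilate-𝟘 n
  dilate-q^ (suc m) zero          = ≡.refl
  dilate-q^ (suc m) (suc zero)    rewrite ℕ.+-suc m (m ℕ.+ 0) = ≡.refl
  dilate-q^ (suc m) (suc (suc n)) rewrite ℕ.+-suc m (m ℕ.+ 0) = dilate-q^ m n

  infixl 6 _⊞_
  infixl 7 _⊠_

  -- Opaque copies of the ring operations: the unifier must not unfold convolutions.
  opaque
    _⊞_ _⊠_ : Series → Series → Series
    _⊞_ = _⊕_
    _⊠_ = _⊛_

    ⊟_ : Series → Series
    ⊟_ = ⊝_

  opaque
    unfolding _⊞_

    ⊞≡⊕ : ∀ A B n → (A ⊞ B) n ≡ A n + B n
    ⊞≡⊕ A B n = ≡.refl

    ⊠≡⊛ : ∀ A B n → (A ⊠ B) n ≡ (A ⊛ B) n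
    ⊠≡⊛ A B n = ≡.refl

    ⊟≡⊝ : ∀ A n → (⊟ A) n ≡ - A n
    ⊟≡⊝ A n = ≡.refl

-- The ring ℤ[q] / (p, q^M).

module Truncated (M p : ℕ) where

  open import Data.Integer.Base using (-_; _+_; _-_; _*_)
  open SeriesAlgebra

  infix 4 _≋_ _≈_

  _≋_ : ℤ → ℤ → Set
  i ≋ j = + p ℤ.∣ i - j

  ≋-by : ∀ {i} j → + p ℤ.∣ j → j ≡ i → + p ℤ.∣ i
  ≋-by j p∣j ≡.refl = p∣j

  ≋-reflexive : ∀ {i j} → i ≡ j → i ≋ j
  ≋-reflexive {i} ≡.refl = ℤ.divides 0ℤ (ℤ.+-inverseʳ i)

  ≋-sym : ∀ {i j} → i ≋ j → j ≋ i
  ≋-sym {i} {j} i≋j = ≋-by (- (i - j)) (ℤ.∣m⇒∣-m i≋j) (ring i j)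
    where
    ring : ∀ i j → - (i - j) ≡ j - i
    ring = ℤSolver.solve-∀

  ≋-trans : ∀ {i j k} → i ≋ j → j ≋ k → i ≋ k
  ≋-trans {i} {j} {k} i≋j j≋k = ≋-by ((i - j) + (j - k)) (ℤ.∣m∣n⇒∣m+n i≋j j≋k) (ring i j k)
    where
    ring : ∀ i j k → (i - j) + (j - k) ≡ i - k
    ring = ℤSolver.solve-∀

  +-≋ : ∀ {i i′ j j′} → i ≋ i′ → j ≋ j′ → i + j ≋ i′ + j′
  +-≋ {i} {i′} {j} {j′} i≋i′ j≋j′ = ≋-by ((i - i′) + (j - j′)) (ℤ.∣m∣n⇒∣m+n i≋i′ j≋j′) (ring i i′ j j′)
    where
    ring : ∀ i i′ j j′ → (i - i′) + (j - j′) ≡ (i + j) - (i′ + j′)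
    ring = ℤSolver.solve-∀

  neg-≋ : ∀ {i j} → i ≋ j → - i ≋ - j
  neg-≋ {i} {j} i≋j = ≋-by (- (i - j)) (ℤ.∣m⇒∣-m i≋j) (ring i j)
    where
    ring : ∀ i j → - (i - j) ≡ - i - - j
    ring = ℤSolver.solve-∀

  *-≋ : ∀ {i i′ j j′} → i ≋ i′ → j ≋ j′ → i * j ≋ i′ * j′
  *-≋ {i} {i′} {j} {j′} i≋i′ j≋j′ =
    ≋-by ((i - i′) * j + i′ * (j - j′)) (ℤ.∣m∣n⇒∣m+n (ℤ.∣m⇒∣m*n j i≋i′) (ℤ.∣n⇒∣m*n i′ j≋j′)) (ring i i′ j j′)
    where
    ring : ∀ i i′ j j′ → (i - i′) * j + i′ * (j - j′) ≡ i * j - i′ * j′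
    ring = ℤSolver.solve-∀

  ∣-≋ : ∀ {i j} → i ≋ j → + p ℤ.∣ j → + p ℤ.∣ i
  ∣-≋ {i} {j} i≋j p∣j = ≋-by ((i - j) + j) (ℤ.∣m∣n⇒∣m+n i≋j p∣j) (ring i j)
    where
    ring : ∀ i j → (i - j) + j ≡ i
    ring = ℤSolver.solve-∀

  -- The hypothesis is on products of coefficients, so that it also compares `F ⊛ θ G` with
  -- `θ F ⊛ G`, whose factors need not be congruent.
  convolution-≋ : ∀ A B C D n → (∀ {i} → i ≤ n → A i * B (n ℕ.∸ i) ≋ C i * D (n ℕ.∸ i)) → (A ⊛ B) n ≋ (C ⊛ D) n
  convolution-≋ A B C D zero    h = +-≋ {A 0 * B 0} {C 0 * D 0} (h z≤n) (≋-reflexive {0ℤ} ≡.refl)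
  convolution-≋ A B C D (suc n) h = +-≋ {A 0 * B (suc n)} {C 0 * D (suc n)} (h z≤n)
    (convolution-≋ (tail A) B (tail C) D n (λ i≤n → h (s≤s i≤n)))

  record _≈_ (A B : Series) : Set where
    constructor congruent
    field coefficient : ∀ {n} → n < M → A n ≋ B n

  open _≈_ public

  pointwise : ∀ {A B} → (∀ n → A n ≡ B n) → A ≈ B
  pointwise A≡B = congruent (λ {n} _ → ≋-reflexive (A≡B n))

  opaque
    unfolding _⊞_

    isCommutativeRing : IsCommutativeRing _≈_ _⊞_ _⊠_ ⊟_ 𝟘 𝟙
    isCommutativeRing = record
      { isRing = record
        { +-isAbelianGroup = record
          { isGroup = record
            { isMonoid = record
              { isSemigroup = record
                { isMagma = record
                  { isEquivalence = record
                    { refl  = λ {A} → pointwise (λ _ → ≡.refl)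
                    ; sym   = λ {A} {B} A≈B → congruent (λ {n} n<M → ≋-sym {A n} {B n} (coefficient A≈B n<M))
                    ; trans = λ {A} {B} {C} A≈B B≈C → congruent (λ {n} n<M → ≋-trans {A n} {B n} {C n} (coefficient A≈B n<M) (coefficient B≈C n<M))
                    }
                  ; ∙-cong = λ {A} {A′} {B} {B′} A≈ B≈ → congruent (λ {n} n<M → +-≋ {A n} {A′ n} {B n} {B′ n} (coefficient A≈ n<M) (coefficient B≈ n<M))
                  }
                ; assoc = λ A B C → pointwise (λ n → ℤ.+-assoc (A n) (B n) (C n))
                }
              ; identity = (λ A → pointwise (λ n → ℤ.+-identityˡ (A n))) , (λ A → pointwise (λ n → ℤ.+-identityʳ (A n)))
              }
            ; inverse = (λ A → pointwise (λ n → ℤ.+-inverseˡ (A n))) , (λ A → pointwise (λ n → ℤ.+-inverseʳ (A n)))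
            ; ⁻¹-cong = λ {A} {B} A≈B → congruent (λ {n} n<M → neg-≋ {A n} {B n} (coefficient A≈B n<M))
            }
          ; comm = λ A B → pointwise (λ n → ℤ.+-comm (A n) (B n))
          }
        ; *-cong = λ {A} {A′} {B} {B′} A≈ B≈ → congruent (λ {n} n<M → convolution-≋ A B A′ B′ n (λ {i} i≤n →
            *-≋ {A i} {A′ i} {B (n ℕ.∸ i)} {B′ (n ℕ.∸ i)} (coefficient A≈ (ℕ.≤-<-trans i≤n n<M))
              (coefficient B≈ (ℕ.≤-<-trans (ℕ.m∸n≤m n i) n<M))))
        ; *-assoc = λ A B C → pointwise (⊛-assoc A B C)
        ; *-identity = (λ A → pointwise (⊛-identityˡ A)) , (λ A → pointwise (λ n → ≡.trans (⊛-comm A 𝟙 n) (⊛-identityˡ A n)))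
        ; distrib = (λ A B C → pointwise (λ n → ≡.trans (⊛-comm A (B ⊕ C) n)
                      (≡.trans (⊛-distribʳ-⊕ A B C n) (≡.cong₂ _+_ (⊛-comm B A n) (⊛-comm C A n)))))
                  , (λ A B C → pointwise (⊛-distribʳ-⊕ A B C))
        }
      ; *-comm = λ A B → pointwise (⊛-comm A B)
      }

  commutativeRing : CommutativeRing 0ℓ 0ℓ
  commutativeRing = record { isCommutativeRing = isCommutativeRing }

  opaque
    unfolding _⊞_

    constants : ℤ-rawRing -Raw-AlmostCommutative⟶ fromCommutativeRing commutativeRing
    constants = record
      { ⟦_⟧    = const
      ; +-homo = λ c d → pointwise (const-+ c d)
      ; *-homo = λ c d → pointwise (const-* c d)
      ; -‿homo = λ c → pointwise (const-neg c)
      ; 0-homo = pointwise (λ { zero → ≡.refl ; (suc _) → ≡.refl })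
      ; 1-homo = pointwise const-1
      }

  open ProductIdentities commutativeRing constants
  open CommutativeRing commutativeRing using (sym; trans; *-cong; *-congˡ; *-comm; *-assoc; *-identityˡ; *-identityʳ; distribʳ; +-cong; +-congˡ; -‿cong; commutativeSemiring; semiring)
  open import Algebra.Properties.CommutativeSemiring.Exp commutativeSemiring using (_^_; ^-congˡ; ^-congʳ; ^-assocʳ)
  open import Algebra.Properties.Semiring.Mult semiring using (_×_)

  q : Series
  q = q^ 1

  q^≈q^ : ∀ m → q ^ m ≈ q^ m
  q^≈q^ m = pointwise (eq m)
    where
    eq : ∀ m n → (q ^ m) n ≡ (q^ m) n
    eq zero    n       = ≡.refl
    eq (suc m) zero    = ⊠≡⊛ q (q ^ m) zero
    eq (suc m) (suc n) = ≡.trans (⊠≡⊛ q (q ^ m) (suc n)) (≡.trans (q-⊛-suc (q ^ m) n) (eq m n))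

  -- The scalar c = ±1 serves q and -q, the two arguments of the Euler product, at once.
  scaled-power-support : ∀ c z → (∀ n → z n ≡ (c · q) n) → ∀ e {i} → e ≢ i → (z ^ e) i ≡ 0ℤ
  scaled-power-support c z z≡cq zero    e≢i = q^-≢ e≢i
  scaled-power-support c z z≡cq (suc e) {i} e≢i =
    ≡.trans (≡.trans (⊠≡⊛ z (z ^ e) i) (≡.trans (⊛-congʳ (z ^ e) z≡cq i) (·-⊛ c q (z ^ e) i))) (≡.trans (≡.cong (c *_) (shifted i e≢i)) (ℤ.*-zeroʳ c))
    where
    shifted : ∀ i → suc e ≢ i → (q ⊛ z ^ e) i ≡ 0ℤ
    shifted zero    _   = ≡.refl
    shifted (suc i) e≢i = ≡.trans (q-⊛-suc (z ^ e) i) (scaled-power-support c z z≡cq e (λ e≡i → e≢i (≡.cong suc e≡i)))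

  scaled-power-nilpotent : ∀ c z → (∀ n → z n ≡ (c · q) n) → z ^ M ≈ 𝟘
  scaled-power-nilpotent c z z≡cq = congruent (λ i<M → ≋-reflexive (scaled-power-support c z z≡cq M (ℕ.>⇒≢ i<M)))

  private
    q≡1·q : ∀ n → q n ≡ (1ℤ · q) n
    q≡1·q n = ≡.sym (ℤ.*-identityˡ (q n))

    -q≡-1·q : ∀ n → (⊟ q) n ≡ ((- 1ℤ) · q) n
    -q≡-1·q n = ≡.trans (⊟≡⊝ q n) (≡.sym (ℤ.-1*i≡-i (q n)))

  ×-coefficient : ∀ n A i → (n × A) i ≡ + n * A i
  ×-coefficient zero    A i = ≡.sym (ℤ.*-zeroˡ (A i))
  ×-coefficient (suc n) A i = ≡.trans (≡.trans (⊞≡⊕ A (n × A) i) (≡.cong (_+_ (A i)) (×-coefficient n A i))) (ring (+ n) (A i))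
    where
    ring : ∀ k a → a + k * a ≡ (1ℤ + k) * a
    ring = ℤSolver.solve-∀

  ×-characteristic : p × 𝟙 ≈ 𝟘
  ×-characteristic = congruent (λ {i} _ → ℤ.divides (𝟙 i)
    (≡.trans (ℤ.+-identityʳ _) (≡.trans (×-coefficient p 𝟙 i) (ℤ.*-comm (+ p) (𝟙 i)))))

  -- Divisibility is read off the constant coefficient, which the truncation retains once M is
  -- positive.
  ×-faithful : ∀ {n} → 0 < M → n × 𝟙 ≈ 𝟘 → p ℕ.∣ n
  ×-faithful {n} 0<M n×1≈0 = ℤ.∣⇒∣ᵤ (≡.subst (+ p ℤ.∣_)
    (≡.trans (ℤ.+-identityʳ _) (≡.trans (×-coefficient n 𝟙 0) (ℤ.*-identityʳ (+ n)))) (coefficient n×1≈0 0<M))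

  PentagonalSupport : Series → Set
  PentagonalSupport A = ∀ {i} → i < M → + p ℤ.∣ A i ⊎ ∃[ u ] u ℕ.* u ≡ 24 ℕ.* i ℕ.+ 1

  euler-support : ∀ c z → (∀ n → z n ≡ (c · q) n) → ∀ {n} → M ≤ n → PentagonalSupport (prod (λ i → 𝟙 ⊞ (⊟ (z ^ suc i))) n)
  euler-support c z z≡cq = Nilpotent.PentagonalSupport.pentagonal z M (scaled-power-nilpotent c z z≡cq) PentagonalSupport
    resp add neg power
    where
    resp : ∀ {A B} → A ≈ B → PentagonalSupport A → PentagonalSupport B
    resp {A} {B} A≈B s {i} i<M with s i<M
    ... | inj₁ p∣A = inj₁ (∣-≋ {B i} {A i} (≋-sym {A i} {B i} (coefficient A≈B i<M)) p∣A)
    ... | inj₂ u   = inj₂ u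
    add : ∀ {A B} → PentagonalSupport A → PentagonalSupport B → PentagonalSupport (A ⊞ B)
    add {A} {B} s t {i} i<M with s i<M | t i<M
    ... | inj₂ u   | _        = inj₂ u
    ... | inj₁ _   | inj₂ u   = inj₂ u
    ... | inj₁ p∣A | inj₁ p∣B = inj₁ (≋-by (A i + B i) (ℤ.∣m∣n⇒∣m+n p∣A p∣B) (≡.sym (⊞≡⊕ A B i)))
    neg : ∀ {A} → PentagonalSupport A → PentagonalSupport (⊟ A)
    neg {A} s {i} i<M with s i<M
    ... | inj₁ p∣A = inj₁ (≋-by (- A i) (ℤ.∣m⇒∣-m p∣A) (≡.sym (⊟≡⊝ A i)))
    ... | inj₂ u   = inj₂ u
    power : ∀ e u → u ℕ.* u ≡ 24 ℕ.* e ℕ.+ 1 → PentagonalSupport (z ^ e)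
    power e u u²≡ {i} i<M with e ℕ.≟ i
    ... | yes ≡.refl = inj₂ (u , u²≡)
    ... | no  e≢i    = inj₁ (ℤ.divides 0ℤ (scaled-power-support c z z≡cq e e≢i))

  -- The residue class of exponents n with p ∣ 24n + 2, that is, 2(24k + 13) for n = 2k + 1.
  Vanishing : Series → Set
  Vanishing A = ∀ {n} → n < M → p ℕ.∣ 24 ℕ.* n ℕ.+ 2 → + p ℤ.∣ A n

  Vanishing-resp-≈ : ∀ {A B} → A ≈ B → Vanishing A → Vanishing B
  Vanishing-resp-≈ {A} {B} A≈B v {n} n<M p∣ = ∣-≋ {B n} {A n} (≋-sym {A n} {B n} (coefficient A≈B n<M)) (v n<M p∣)

  -- With j = p(m + 1), coefficient n of A is coefficient n of A(1 - q^j) plus coefficient n - j of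
  -- A. As p divides j, the index n - j stays in the same residue class, and strong induction
  -- applies.
  Vanishing-cancel : ∀ A m → Vanishing (A ⊠ (𝟙 ⊞ (⊟ q^ (p ℕ.* suc m)))) → 0 < p → Vanishing A
  Vanishing-cancel A m v 0<p {n} = <-rec P step n
    where
    j = p ℕ.* suc m
    0<j : 0 < j
    0<j = ℕ.*-mono-≤ 0<p (s≤s z≤n)
    P : ℕ → Set
    P n = n < M → p ℕ.∣ 24 ℕ.* n ℕ.+ 2 → + p ℤ.∣ A n
    coefficient-* : ∀ n → (A ⊠ (𝟙 ⊞ (⊟ q^ j))) n ≡ A n - (q^ j ⊛ A) n
    coefficient-* n = ≡.trans (⊠≡⊛ A _ n) (≡.trans (⊛-comm A (𝟙 ⊞ (⊟ q^ j)) n)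
      (≡.trans (⊛-congʳ A (λ i → ≡.trans (⊞≡⊕ 𝟙 (⊟ q^ j) i) (≡.cong (_+_ (𝟙 i)) (≡.trans (⊟≡⊝ (q^ j) i) (≡.sym (ℤ.-1*i≡-i ((q^ j) i)))))) n)
      (≡.trans (⊛-distribʳ-⊕ A 𝟙 ((- 1ℤ) · q^ j) n)
      (≡.cong₂ _+_ (⊛-identityˡ A n) (≡.trans (·-⊛ (- 1ℤ) (q^ j) A n) (ℤ.-1*i≡-i ((q^ j ⊛ A) n)))))))
    step : ∀ n → (∀ {k} → k < n → P k) → P n
    step n ih n<M p∣ = ≋-by ((A ⊠ (𝟙 ⊞ (⊟ q^ j))) n + (q^ j ⊛ A) n) (ℤ.∣m∣n⇒∣m+n (v n<M p∣) shifted)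
      (≡.trans (≡.cong (_+ (q^ j ⊛ A) n) (coefficient-* n)) (ring (A n) ((q^ j ⊛ A) n)))
      where
      ring : ∀ a b → a - b + b ≡ a
      ring = ℤSolver.solve-∀
      shifted : + p ℤ.∣ (q^ j ⊛ A) n
      shifted with n ℕ.<? j
      ... | yes n<j = ℤ.divides 0ℤ (q^-⊛-< A n<j)
      ... | no  n≮j = ≡.subst (+ p ℤ.∣_) (≡.trans (≡.sym (q^-⊛-+ j A k)) (≡.cong (q^ j ⊛ A) j+k≡n))
        (ih k<n (ℕ.<-trans k<n n<M) (ℕ.∣m+n∣m⇒∣n (≡.subst (p ℕ.∣_) split p∣) (ℕ.∣n⇒∣m*n 24 (ℕ.m∣m*n (suc m)))))
        where
        k = n ℕ.∸ j
        j+k≡n : j ℕ.+ k ≡ n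
        j+k≡n = ℕ.m+[n∸m]≡n (ℕ.≮⇒≥ n≮j)
        k<n : k < n
        k<n = ≡.subst (k <_) j+k≡n (ℕ.m<n+m k 0<j)
        split : 24 ℕ.* n ℕ.+ 2 ≡ 24 ℕ.* j ℕ.+ (24 ℕ.* k ℕ.+ 2)
        split = ≡.trans (≡.cong (λ n → 24 ℕ.* n ℕ.+ 2) (≡.sym j+k≡n)) (ring′ j k)
          where
          ring′ : ∀ j k → 24 ℕ.* (j ℕ.+ k) ℕ.+ 2 ≡ 24 ℕ.* j ℕ.+ (24 ℕ.* k ℕ.+ 2)
          ring′ = ℕSolver.solve-∀

  Vanishing-cancel-prod : ∀ A (z : ℕ → Series) (k : ℕ → ℕ) → (∀ i → z i ≈ q^ (p ℕ.* suc (k i))) → 0 < p →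
    ∀ n → Vanishing (A ⊠ prod (λ i → 𝟙 ⊞ (⊟ z i)) n) → Vanishing A
  Vanishing-cancel-prod A z k z≈ 0<p zero    v = Vanishing-resp-≈ (*-identityʳ A) v
  Vanishing-cancel-prod A z k z≈ 0<p (suc n) v = Vanishing-cancel-prod A z k z≈ 0<p n
    (Vanishing-cancel (A ⊠ prod (λ i → 𝟙 ⊞ (⊟ z i)) n) (k n) (Vanishing-resp-≈
      (trans (*-congˡ (*-comm _ _)) (trans (sym (*-assoc A _ _)) (*-congˡ (+-congˡ (-‿cong (z≈ n)))))) v) 0<p)

  dilate-* : ∀ A B → dilate (A ⊛ B) ≈ dilate A ⊠ dilate B
  dilate-* A B = pointwise (λ n → ≡.trans (dilate-⊛ A B n) (≡.sym (⊠≡⊛ (dilate A) (dilate B) n)))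

  dilate-f-partial : ∀ k n → dilate (f-partial k n) ≈ prod (λ i → 𝟙 ⊞ (⊟ q^ (2 ℕ.* (k ℕ.* suc i)))) n
  dilate-f-partial k zero    = pointwise (dilate-q^ 0)
  dilate-f-partial k (suc n) = trans (dilate-* (𝟙 ⊖ q^ (k ℕ.* suc n)) (f-partial k n)) (*-cong (pointwise factor) (dilate-f-partial k n))
    where
    factor : ∀ i → dilate (𝟙 ⊖ q^ (k ℕ.* suc n)) i ≡ (𝟙 ⊞ (⊟ q^ (2 ℕ.* (k ℕ.* suc n)))) i
    factor i = ≡.trans (dilate-⊖ 𝟙 (q^ (k ℕ.* suc n)) i) (≡.trans
      (≡.cong₂ _-_ (dilate-q^ 0 i) (dilate-q^ (k ℕ.* suc n) i))
      (≡.sym (≡.trans (⊞≡⊕ 𝟙 _ i) (≡.cong (_+_ (𝟙 i)) (⊟≡⊝ (q^ (2 ℕ.* (k ℕ.* suc n))) i)))))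

  dilate-f : ∀ k .{{_ : ℕ.NonZero k}} {n} → M ≤ n → dilate (f k) ≈ prod (λ i → 𝟙 ⊞ (⊟ q^ (2 ℕ.* (k ℕ.* suc i)))) n
  dilate-f k {n} M≤n = trans (congruent (λ {i} i<M → ≋-reflexive (dilate-cong i (λ m≤i →
    ≡.sym (f-stable k (ℕ.≤-trans m≤i (ℕ.≤-trans (ℕ.<⇒≤ i<M) M≤n))))))) (dilate-f-partial k n)

  dilate-^^ : ∀ A m → dilate (A ^^ m) ≈ dilate A ^ m
  dilate-^^ A zero    = pointwise (dilate-q^ 0)
  dilate-^^ A (suc m) = trans (dilate-* A (A ^^ m)) (*-congˡ (dilate-^^ A m))

  θ-⊞ : ∀ A B → θ (A ⊞ B) ≈ θ A ⊞ θ B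
  θ-⊞ A B = pointwise (λ n → ≡.trans (≡.cong (+ n *_) (⊞≡⊕ A B n))
    (≡.trans (ℤ.*-distribˡ-+ (+ n) (A n) (B n)) (≡.sym (⊞≡⊕ (θ A) (θ B) n))))

  θ-⊟ : ∀ A → θ (⊟ A) ≈ ⊟ θ A
  θ-⊟ A = pointwise (λ n → ≡.trans (≡.cong (+ n *_) (⊟≡⊝ A n))
    (≡.trans (≡.sym (ℤ.neg-distribʳ-* (+ n) (A n))) (≡.sym (⊟≡⊝ (θ A) n))))

  θ-⊠ : ∀ A B → θ (A ⊠ B) ≈ θ A ⊠ B ⊞ A ⊠ θ B
  θ-⊠ A B = pointwise (λ n → ≡.trans (≡.cong (+ n *_) (⊠≡⊛ A B n)) (≡.trans (θ-⊛ A B n)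
    (≡.sym (≡.trans (⊞≡⊕ (θ A ⊠ B) (A ⊠ θ B) n) (≡.cong₂ _+_ (⊠≡⊛ (θ A) B n) (⊠≡⊛ A (θ B) n))))))

  θ-cong : ∀ {A B} → A ≈ B → θ A ≈ θ B
  θ-cong {A} {B} A≈B = congruent (λ {n} n<M → *-≋ {+ n} {+ n} {A n} {B n} (≋-reflexive {+ n} ≡.refl) (coefficient A≈B n<M))

  θ-𝟙 : θ 𝟙 ≈ 𝟘
  θ-𝟙 = pointwise (λ { zero → ≡.refl ; (suc n) → ℤ.*-zeroʳ (+ suc n) })

  θ-q : θ q ≈ q
  θ-q = pointwise (λ { zero → ≡.refl ; (suc zero) → ≡.refl ; (suc (suc n)) → ℤ.*-zeroʳ (+ suc (suc n)) })

  q-nilpotent : q ^ M ≈ 𝟘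
  q-nilpotent = scaled-power-nilpotent 1ℤ q q≡1·q

  open Wronskian q M q-nilpotent θ θ-cong θ-⊞ θ-⊟ θ-⊠ θ-𝟙 θ-q

  private
    N = suc M
    M≤N : M ≤ N
    M≤N = ℕ.n≤1+n M

  module T = Nilpotent (q ⊠ q) M (Nilpotent.multiple-nilpotent q M q-nilpotent q)

  q²-power : ∀ m → (q ⊠ q) ^ m ≈ q^ (2 ℕ.* m)
  q²-power m = trans (sym (^-even q m)) (q^≈q^ (2 ℕ.* m))

  q⁴-power : ∀ i → (q ⊠ q) ⊠ ((q ⊠ q) ⊠ ((q ⊠ q) ⊠ (q ⊠ q)) ^ i) ≈ q^ (2 ℕ.* (2 ℕ.* suc i))
  q⁴-power i = trans (trans (sym (*-assoc (q ⊠ q) (q ⊠ q) _)) (sym (^-even (q ⊠ q) (suc i)))) (q²-power (2 ℕ.* suc i))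

  -- Under q ↦ q² the product f₁ becomes `euler₂` and f₂ becomes `T.E N`.
  generating : ∀ e → dilate (a (suc e)) ⊠ (euler₂ ⊠ T.E N ^ e) ≈ 𝟙
  generating e = trans (*-congˡ (*-cong f₁ (^-congˡ e f₂)))
    (trans (*-congˡ (trans (*-congˡ (sym (dilate-^^ (f 2) e))) (sym (dilate-* (f 1) (f 2 ^^ e)))))
    (trans (sym (dilate-* (a (suc e)) (f 1 ⊛ f 2 ^^ e)))
    (pointwise (λ n → ≡.trans (dilate-cong n (λ {m} _ → a-generating (suc e) m)) (dilate-q^ 0 n)))))
    where
    f₁ : euler₂ ≈ dilate (f 1)
    f₁ = trans (prod-cong (λ i → +-congˡ (-‿cong (trans (q²-power (suc i))
      (pointwise (λ n → ≡.cong (λ m → (q^ (2 ℕ.* m)) n) (≡.sym (ℕ.*-identityˡ (suc i)))))))) N) (sym (dilate-f 1 M≤N))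
    f₂ : T.E N ≈ dilate (f 2)
    f₂ = trans (prod-cong (λ i → +-congˡ (-‿cong (q⁴-power i))) N) (sym (dilate-f 2 M≤N))

  -- Vanishing of the coefficients for a prime p = 4m + 3.

  module Congruence
    (0<M : 0 < M) (p-prime : Prime p) (e : ℕ) (p≡e+7 : p ≡ 7 ℕ.+ e)
    (m : ℕ) (p≡4m+3 : p ≡ suc (2 ℕ.* suc (2 ℕ.* m)))
    where

    open Characteristic p p-prime ×-characteristic
    open Odd (suc (2 ℕ.* m)) p≡4m+3

    -- The bound 7 comes from p = 7 + e. It allows the factors 2, 4 and 6 to be cancelled, and 24 in
    -- the form 6 · 4.
    small-∤ : ∀ k .{{_ : ℕ.NonZero k}} → k < 7 → ¬ (p ℕ.∣ k)
    small-∤ k k<7 = ℕ.>⇒∤ (ℕ.<-≤-trans k<7 (≡.subst (7 ≤_) (≡.sym p≡e+7) (ℕ.m≤m+n 7 e)))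

    euclid : ∀ k .{{_ : ℕ.NonZero k}} → k < 7 → ∀ n → p ℕ.∣ k ℕ.* n → p ℕ.∣ n
    euclid k k<7 n p∣kn with euclidsLemma k n p-prime p∣kn
    ... | inj₁ p∣k = contradiction p∣k (small-∤ k k<7)
    ... | inj₂ p∣n = p∣n

    -- Here p divides 2uv, hence u or v. In the second case u² is what remains of the sum after the
    -- multiple v² of p.
    ∣-sum-of-squares : ∀ u v → p ℕ.∣ u ℕ.* u ℕ.+ v ℕ.* v → p ℕ.∣ u ℕ.* u
    ∣-sum-of-squares u v p∣ = [ ℕ.∣m⇒∣m*n u , (λ p∣v → ℕ.∣m+n∣m⇒∣n p∣′ (ℕ.∣m⇒∣m*n v p∣v)) ]′
      (euclidsLemma u v p-prime (euclid 2 (s≤s (s≤s (s≤s z≤n))) (u ℕ.* v) (×-faithful 0<M (∣-squares⇒2ab≈0 m ≡.refl u v p∣))))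
      where
      p∣′ : p ℕ.∣ v ℕ.* v ℕ.+ u ℕ.* u
      p∣′ = ≡.subst (p ℕ.∣_) (ℕ.+-comm (u ℕ.* u) (v ℕ.* v)) p∣

    euclid-ℤ : ∀ k .{{_ : ℕ.NonZero k}} → k < 7 → ∀ d → + p ℤ.∣ + k * d → + p ℤ.∣ d
    euclid-ℤ k k<7 d p∣kd = ℤ.∣ᵤ⇒∣ (euclid k k<7 ℤ.∣ d ∣ (≡.subst (p ℕ.∣_) (ℤ.abs-* (+ k) d) (ℤ.∣⇒∣ᵤ p∣kd)))

    difference-∣ : ∀ c i j → p ℕ.∣ c ℕ.* i ℕ.+ 1 → p ℕ.∣ c ℕ.* j ℕ.+ 1 → + p ℤ.∣ + c * (+ j - + i)
    difference-∣ c i j p∣ci+1 p∣cj+1 = ≋-by ((+ c * + j + 1ℤ) - (+ c * + i + 1ℤ))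
      (ℤ.∣m∣n⇒∣m-n (cast j p∣cj+1) (cast i p∣ci+1)) (ring (+ c) (+ j) (+ i))
      where
      ring : ∀ c j i → (c * j + 1ℤ) - (c * i + 1ℤ) ≡ c * (j - i)
      ring = ℤSolver.solve-∀
      cast : ∀ k → p ℕ.∣ c ℕ.* k ℕ.+ 1 → + p ℤ.∣ + c * + k + 1ℤ
      cast k p∣ck+1 = ≡.subst (+ p ℤ.∣_) (≡.trans (ℤ.pos-+ (c ℕ.* k) 1) (≡.cong (_+ 1ℤ) (ℤ.pos-* c k))) (ℤ.∣ᵤ⇒∣ p∣ck+1)

    squares-congruent : ∀ i j u v → u ℕ.* u ≡ 24 ℕ.* i ℕ.+ 1 → v ℕ.* v ≡ 24 ℕ.* j ℕ.+ 1 →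
      p ℕ.∣ 24 ℕ.* (i ℕ.+ j) ℕ.+ 2 → + p ℤ.∣ + j - + i
    squares-congruent i j u v u² v² p∣ = euclid-ℤ 4 (s≤s (s≤s (s≤s (s≤s (s≤s z≤n))))) (+ j - + i)
      (euclid-ℤ 6 ℕ.≤-refl (+ 4 * (+ j - + i)) (≡.subst (+ p ℤ.∣_) (ℤ.*-assoc (+ 6) (+ 4) (+ j - + i)) (difference-∣ 24 i j
        (≡.subst (p ℕ.∣_) u² (∣-sum-of-squares u v p∣u²+v²))
        (≡.subst (p ℕ.∣_) v² (∣-sum-of-squares v u (≡.subst (p ℕ.∣_) (ℕ.+-comm (u ℕ.* u) (v ℕ.* v)) p∣u²+v²))))))
      where
      ring : ∀ c i j → c ℕ.* (i ℕ.+ j) ℕ.+ 2 ≡ (c ℕ.* i ℕ.+ 1) ℕ.+ (c ℕ.* j ℕ.+ 1)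
      ring = ℕSolver.solve-∀
      p∣u²+v² : p ℕ.∣ u ℕ.* u ℕ.+ v ℕ.* v
      p∣u²+v² = ≡.subst (p ℕ.∣_) (≡.trans (ring 24 i j) (≡.cong₂ ℕ._+_ (≡.sym u²) (≡.sym v²))) p∣

    wronskian-vanishing : ∀ F G → PentagonalSupport F → PentagonalSupport G → Vanishing (wronskian F G)
    wronskian-vanishing F G F-support G-support {n} n<M p∣24n+2 =
      ≋-by ((F ⊛ θ G) n - (θ F ⊛ G) n) (convolution-≋ F (θ G) (θ F) G n term)
        (≡.sym (≡.trans (⊞≡⊕ (F ⊠ θ G) (⊟ (θ F ⊠ G)) n) (≡.cong₂ _+_ (⊠≡⊛ F (θ G) n)
          (≡.trans (⊟≡⊝ (θ F ⊠ G) n) (≡.cong -_ (⊠≡⊛ (θ F) G n))))))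
      where
      divisible : ∀ i j → i ℕ.+ j ≡ n →
        + p ℤ.∣ F i ⊎ ∃[ u ] u ℕ.* u ≡ 24 ℕ.* i ℕ.+ 1 → + p ℤ.∣ G j ⊎ ∃[ v ] v ℕ.* v ≡ 24 ℕ.* j ℕ.+ 1 →
        + p ℤ.∣ (+ j - + i) * (F i * G j)
      divisible i j i+j≡n (inj₁ p∣F) _ = ℤ.∣n⇒∣m*n (+ j - + i) (ℤ.∣m⇒∣m*n (G j) p∣F)
      divisible i j i+j≡n (inj₂ _) (inj₁ p∣G) = ℤ.∣n⇒∣m*n (+ j - + i) (ℤ.∣n⇒∣m*n (F i) p∣G)
      divisible i j ≡.refl (inj₂ (u , u²)) (inj₂ (v , v²)) =
        ℤ.∣m⇒∣m*n (F i * G j) (squares-congruent i j u v u² v² p∣24n+2)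
      term : ∀ {i} → i ≤ n → F i * (+ (n ℕ.∸ i) * G (n ℕ.∸ i)) ≋ (+ i * F i) * G (n ℕ.∸ i)
      term {i} i≤n = ≋-by ((+ j - + i) * (F i * G j))
        (divisible i j (ℕ.m+[n∸m]≡n i≤n) (F-support (ℕ.≤-<-trans i≤n n<M)) (G-support (ℕ.≤-<-trans (ℕ.m∸n≤m n i) n<M)))
        (ring (+ j) (+ i) (F i) (G j))
        where
        j = n ℕ.∸ i
        ring : ∀ j i a b → (j - i) * (a * b) ≡ a * (j * b) - (i * a) * b
        ring = ℤSolver.solve-∀

    -- `ℕ.pred` brings the positive exponent 4(i + 1) to the form `suc k` that
    -- `Vanishing-cancel-prod` asks for.
    q⁴-power-p : ∀ i → ((q ⊠ q) ⊠ ((q ⊠ q) ⊠ ((q ⊠ q) ⊠ (q ⊠ q)) ^ i)) ^ p ≈ q^ (p ℕ.* suc (ℕ.pred (2 ℕ.* (2 ℕ.* suc i))))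
    q⁴-power-p i = trans (^-congˡ p (trans (q⁴-power i) (sym (q^≈q^ (2 ℕ.* (2 ℕ.* suc i))))))
      (trans (^-assocʳ q (2 ℕ.* (2 ℕ.* suc i)) p) (trans (^-congʳ q (ℕ.*-comm (2 ℕ.* (2 ℕ.* suc i)) p)) (q^≈q^ (p ℕ.* (2 ℕ.* (2 ℕ.* suc i))))))

    quotient : Series
    quotient = (𝟙 ⊞ 𝟙) ⊠ (q ⊠ dilate (a (suc e)))

    quotient-vanishing : Vanishing quotient
    quotient-vanishing = Vanishing-cancel-prod quotient _ _ q⁴-power-p 0<p N
      (Vanishing-resp-≈ wronskian≈ (wronskian-vanishing euler[q] euler[-q]
        (euler-support 1ℤ q q≡1·q M≤2N) (euler-support (- 1ℤ) (⊟ q) -q≡-1·q M≤2N)))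
      where
      0<p : 0 < p
      0<p = ≡.subst (0 <_) (≡.sym p≡e+7) (s≤s z≤n)
      M≤2N : M ≤ 2 ℕ.* N
      M≤2N = ℕ.≤-trans M≤N (ℕ.m≤m+n N _)
      wronskian≈ : wronskian euler[q] euler[-q] ≈
        quotient ⊠ prod (λ i → 𝟙 ⊞ (⊟ (((q ⊠ q) ⊠ ((q ⊠ q) ⊠ ((q ⊠ q) ⊠ (q ⊠ q)) ^ i)) ^ p))) N
      -- As 7 + e = p, Frobenius turns each factor 1 - q^{4(i+1)} of `T.E N` into 1 - q^{4(i+1)p},
      -- and such factors can be cancelled.
      wronskian≈ = trans (wronskian-quotient e (generating e))
        (*-congˡ (trans (^-congʳ (T.E N) (≡.sym p≡e+7)) (frobenius-prod _ N)))

    congruence : ∀ n → suc (2 ℕ.* n) < M → p ℕ.∣ 24 ℕ.* n ℕ.+ 13 → + p ℤ.∣ a (suc e) n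
    congruence n n<M p∣24n+13 = euclid-ℤ 2 (s≤s (s≤s (s≤s z≤n))) (a (suc e) n)
      (≋-by ((Y ⊞ Y) (suc (2 ℕ.* n))) (Vanishing-resp-≈ doubled quotient-vanishing n<M (≡.subst (p ℕ.∣_) (ring n) (ℕ.∣n⇒∣m*n 2 p∣24n+13)))
        (≡.trans (⊞≡⊕ Y Y _) (≡.trans (≡.cong₂ _+_ Y≡ Y≡) (ring′ (a (suc e) n)))))
      where
      Y : Series
      Y = q ⊠ dilate (a (suc e))
      doubled : quotient ≈ Y ⊞ Y
      doubled = trans (distribʳ Y 𝟙 𝟙) (+-cong (*-identityˡ Y) (*-identityˡ Y))
      Y≡ : Y (suc (2 ℕ.* n)) ≡ a (suc e) n
      Y≡ = ≡.trans (⊠≡⊛ q _ _) (≡.trans (q-⊛-suc (dilate (a (suc e))) (2 ℕ.* n)) (dilate-even (a (suc e)) n))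
      ring : ∀ n → 2 ℕ.* (24 ℕ.* n ℕ.+ 13) ≡ 24 ℕ.* suc (2 ℕ.* n) ℕ.+ 2
      ring = ℕSolver.solve-∀
      ring′ : ∀ i → i + i ≡ + 2 * i
      ring′ = ℤSolver.solve-∀

cubic-congruence : ∀ p → Prime p → ∀ c .{{_ : ℕ.NonZero c}} m → p ≡ 6 ℕ.+ c → p ≡ suc (2 ℕ.* suc (2 ℕ.* m)) →
  ∀ n → p ℕ.∣ 24 ℕ.* n ℕ.+ 13 → + p ∣ᵤ a c n
cubic-congruence p p-prime zero {{0≢0}} = contradiction ≡.refl (ℕ.≢-nonZero⁻¹ 0 {{0≢0}})
cubic-congruence p p-prime (suc e) m p≡c+6 p≡4m+3 n p∣ = ℤ.∣⇒∣ᵤ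
  -- The coefficient in question sits at exponent 2n + 1, so M = 2n + 2 is the least truncation that
  -- retains it.
  (Truncated.Congruence.congruence (2 ℕ.+ 2 ℕ.* n) p (s≤s z≤n) p-prime e (≡.trans p≡c+6 (ℕ.+-suc 6 e)) m p≡4m+3 n ℕ.≤-refl p∣)

cubic-congruence-class : ∀ p → Prime p → ∀ c .{{_ : ℕ.NonZero c}} m → p ≡ 6 ℕ.+ c → p ≡ suc (2 ℕ.* suc (2 ℕ.* m)) →
  ∀ r → p ℕ.∣ 24 ℕ.* r ℕ.+ 13 → ∀ n → + p ∣ᵤ a c (p ℕ.* n ℕ.+ r)
cubic-congruence-class p p-prime c m p≡c+6 p≡4m+3 r p∣ n = cubic-congruence p p-prime c m p≡c+6 p≡4m+3 (p ℕ.* n ℕ.+ r)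
  (≡.subst (p ℕ.∣_) (≡.sym (ring 24 p n r)) (ℕ.∣m∣n⇒∣m+n (ℕ.∣n⇒∣m*n 24 (ℕ.m∣m*n n)) p∣))
  where
  ring : ∀ c p n r → c ℕ.* (p ℕ.* n ℕ.+ r) ℕ.+ 13 ≡ c ℕ.* (p ℕ.* n) ℕ.+ (c ℕ.* r ℕ.+ 13)
  ring = ℕSolver.solve-∀

open import Data.Nat using (_+_; _*_)
open import Data.Integer.Divisibility using (_∣_)
open import Data.Product using (_×_)

theorem1p1 : (n : ℕ) →
    (+ 43 ∣ a 37 (43 * n + 12))
    × (+ 47 ∣ a 41 (47 * n + 21))
    × (+ 59 ∣ a 53 (59 * n + 56))
    × (+ 67 ∣ a 61 (67 * n + 19))
    × (+ 71 ∣ a 65 (71 * n + 32))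
    × (+ 79 ∣ a 73 (79 * n + 62))
    × (+ 83 ∣ a 77 (83 * n + 79))
theorem1p1 n =
    -- After p and c comes m with p = 4m + 3. The offset r solves 24r + 13 ≡ 0 modulo p, and
    -- `ℕ.divides` is given the cofactor (24r + 13) / p.
    cubic-congruence-class 43 (from-yes (prime? 43)) 37 10 ≡.refl ≡.refl 12 (ℕ.divides 7 ≡.refl) n
  , cubic-congruence-class 47 (from-yes (prime? 47)) 41 11 ≡.refl ≡.refl 21 (ℕ.divides 11 ≡.refl) n
  , cubic-congruence-class 59 (from-yes (prime? 59)) 53 14 ≡.refl ≡.refl 56 (ℕ.divides 23 ≡.refl) n
  , cubic-congruence-class 67 (from-yes (prime? 67)) 61 16 ≡.refl ≡.refl 19 (ℕ.divides 7 ≡.refl) n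
  , cubic-congruence-class 71 (from-yes (prime? 71)) 65 17 ≡.refl ≡.refl 32 (ℕ.divides 11 ≡.refl) n
  , cubic-congruence-class 79 (from-yes (prime? 79)) 73 19 ≡.refl ≡.refl 62 (ℕ.divides 19 ≡.refl) n
  , cubic-congruence-class 83 (from-yes (prime? 83)) 77 20 ≡.refl ≡.refl 79 (ℕ.divides 23 ≡.refl) n
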